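{- Let $q$ be an odd prime power, $d\ge2$, $Q$ a nondegenerate quadratic form on $\mathbb F_q^d$. Let $P\subseteq\mathbb F_q^d$ be nonempty, let $\mathcal S$ be a nonempty family of distinct $Q$-spheres, and let $K>0$. Suppose $$\sigma(P,\mathcal S)\ge Kq^{(d-1)/2}\sqrt{|P||\mathcal S|}\qquad\text{and}\qquad K^2q^{d-1}|\mathcal S|\ge4|P|.$$ Then at least $K^2|\mathcal S|/4$ ordered pairs $(S,S')$ of distinct spheres in $\mathcal S$ satisfy $$|P\cap S\cap S'|\ge\frac{K^2q^{d-1}}{4|\mathcal S|}.\tag{*}$$ Every such pair supplies a radical hyperplane $H(S,S')$ with $|P\cap H(S,S')|$ at least the same number. At least $K^2/8$ spheres of $\mathcal S$ each have at least $K^2/8$ witnessing partners. If $d\ge3$, at least $K^2q|\mathcal S|/8$ ordered pairs satisfy (*), and at least $K^2q/16$ spheres each have at least $K^2q/16$ witnessing partners.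
   Context: Put $\langle x,y\rangle_Q=\frac{Q(x+y)-Q(x)-Q(y)}2$. For $c\in\mathbb F_q^d$, $r\in\mathbb F_q$ the $Q$-sphere is $S_Q(c,r)=\{x\in\mathbb F_q^d:Q(x-c)=r\}$; spheres are parametrized by pairs $(c,r)$ and distinct spheres means distinct parameter pairs. $\sigma(P,\mathcal S)=|\{(p,S)\in P\times\mathcal S:p\in S\}|-|P||\mathcal S|/q$. For spheres $S=S_Q(c,r)$, $S'=S_Q(c',r')$ with $c\ne c'$, the radical hyperplane is the affine hyperplane $$H(S,S')=\{x\in\mathbb F_q^d:2\langle c'-c,x\rangle_Q=(r-r')-Q(c)+Q(c')\},$$ which contains $S\cap S'$; two distinct spheres with the same center are disjoint, so every pair satisfying (*) has $c\neq c'$. A witnessing partner of $S\in\mathcal S$ is a sphere $S'\in\mathcal S$, $S'\ne S$, such that $(S,S')$ satisfies (*). -}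

module Defs where

open import Level using (Level; _⊔_) renaming (suc to lsuc)
open import Algebra.Core using (Op₁; Op₂)
open import Algebra.Structures using (IsCommutativeRing)
open import Data.Fin.Base using (Fin)
import Data.Fin.Properties as Fin
open import Data.List.Base using (List; length; filter; cartesianProduct)
open import Data.Nat.Base as ℕ using (ℕ; zero; suc)
open import Data.Nat.Divisibility using (_∤_)
open import Data.Nat.Primality using (Prime)
open import Data.Product using (_×_; _,_; ∃₂; proj₁; proj₂)
open import Data.Product.Properties renaming (≡-dec to ×-≡-dec)
open import Data.Vec.Base using (Vec; zipWith; map; replicate)
open import Data.Vec.Properties renaming (≡-dec to Vec-≡-dec)
open import Function.Bundles using (_↔_)
open import Function.Properties.Inverse using (↔⇒↣)
open import Relation.Binary.Core using (Rel)
open import Relation.Binary.Definitions using (DecidableEquality)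
open import Relation.Binary.PropositionalEquality using (_≡_; _≢_)
open import Relation.Binary.Structures using (IsDecTotalOrder)
open import Relation.Nullary.Decidable using (Dec; ¬?; _×-dec_; via-injection)
open import Relation.Nullary.Negation using (¬_)
open import Relation.Unary using (Pred; Decidable)

-- As usual for a total inverse operation, the value of 0# ⁻¹ is unspecified.
record IsField {a ℓ} {A : Set a} (_≈_ : Rel A ℓ) (_+_ _*_ : Op₂ A) (-_ : Op₁ A)
               (0# 1# : A) (_⁻¹ : Op₁ A) : Set (a ⊔ ℓ) where
  field
    isCommutativeRing : IsCommutativeRing _≈_ _+_ _*_ -_ 0# 1#
    0≉1               : ¬ (0# ≈ 1#)
    ⁻¹-cong           : ∀ {x y} → x ≈ y → (x ⁻¹) ≈ (y ⁻¹)
    ⁻¹-inverseʳ       : ∀ x → ¬ (x ≈ 0#) → (x * (x ⁻¹)) ≈ 1#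
  open IsCommutativeRing isCommutativeRing public

-- The real numbers enter only through ordered-field arithmetic, decidable
-- comparison (classically always available) and square roots of nonnegative
-- elements.  Statements are therefore made for an arbitrary ordered field with
-- these properties; classically the field of real numbers is one of them.
record EuclideanField a ℓ₁ ℓ₂ : Set (lsuc (a ⊔ ℓ₁ ⊔ ℓ₂)) where
  infix  8 _⁻¹
  infix  8 -_
  infixl 7 _*_ _/_
  infixl 6 _+_ _-_
  infix  4 _≈_ _≤_ _<_
  field
    Carrier : Set a
    _≈_     : Rel Carrier ℓ₁
    _≤_     : Rel Carrier ℓ₂
    _+_ _*_ : Op₂ Carrier
    -_ _⁻¹  : Op₁ Carrier
    0# 1#   : Carrier
    √_      : Op₁ Carrier
    isField         : IsField _≈_ _+_ _*_ -_ 0# 1# _⁻¹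
    isDecTotalOrder : IsDecTotalOrder _≈_ _≤_
    +-monoʳ-≤  : ∀ x {y z} → y ≤ z → x + y ≤ x + z
    *-nonNeg   : ∀ {x y} → 0# ≤ x → 0# ≤ y → 0# ≤ x * y
    √-cong     : ∀ {x y} → x ≈ y → √ x ≈ √ y
    √-nonNeg   : ∀ {x} → 0# ≤ x → 0# ≤ √ x
    √-square   : ∀ {x} → 0# ≤ x → √ x * √ x ≈ x

  open IsField isField public
    hiding (isEquivalence; refl; sym; trans; reflexive; _-_; isPartialEquivalence)
  open IsDecTotalOrder isDecTotalOrder public using (_≤?_)

  _-_ _/_ : Op₂ Carrier
  x - y = x + (- y)
  x / y = x * (y ⁻¹)

  _<_ : Rel Carrier (ℓ₁ ⊔ ℓ₂)
  x < y = (x ≤ y) × (¬ (x ≈ y))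

  ι : ℕ → Carrier
  ι zero    = 0#
  ι (suc n) = 1# + ι n

record FiniteField c (q : ℕ) : Set (lsuc c) where
  infix  8 _⁻¹
  infix  8 -_
  infixl 7 _*_
  infixl 6 _+_ _-_
  field
    Carrier : Set c
    _+_ _*_ : Op₂ Carrier
    -_ _⁻¹  : Op₁ Carrier
    0# 1#   : Carrier
    isField     : IsField _≡_ _+_ _*_ -_ 0# 1# _⁻¹
    enumeration : Carrier ↔ Fin q

  open IsField isField public
    hiding (isEquivalence; refl; sym; trans; reflexive; _-_; isPartialEquivalence)

  _-_ : Op₂ Carrier
  x - y = x + (- y)

  2# : Carrier
  2# = 1# + 1#

  _≟_ : DecidableEquality Carrier
  _≟_ = via-injection (↔⇒↣ enumeration) Fin._≟_

OddPrimePower : ℕ → Set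
OddPrimePower q = (∃₂ λ p k → Prime p × 1 ℕ.≤ k × q ≡ p ℕ.^ k) × 2 ∤ q

module _ {a p} {A : Set a} {P : Pred A p} where

  count : Decidable P → List A → ℕ
  count P? xs = length (filter P? xs)

module Geometry {c q} (𝔽 : FiniteField c q) {d : ℕ}
                (Q : Vec (FiniteField.Carrier 𝔽) d → FiniteField.Carrier 𝔽) where
  open FiniteField 𝔽

  infixl 6 _⊕_ _⊖_
  infixr 7 _·_

  Point : Set c
  Point = Vec Carrier d

  _⊕_ _⊖_ : Op₂ Point
  _⊕_ = zipWith _+_
  _⊖_ = zipWith _-_

  _·_ : Carrier → Point → Point
  a · x = map (a *_) x

  𝟎 : Point
  𝟎 = replicate d 0#

  ⟨_,_⟩ : Point → Point → Carrier
  ⟨ x , y ⟩ = ((Q (x ⊕ y) - Q x) - Q y) * (2# ⁻¹)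

  -- ⟨_,_⟩ is symmetric by construction, so linearity in the first argument
  -- amounts to bilinearity.
  record IsQuadraticForm : Set c where
    field
      homogeneous : ∀ a x → Q (a · x) ≡ (a * a) * Q x
      ⟨⟩-additive : ∀ x y z → ⟨ x ⊕ y , z ⟩ ≡ ⟨ x , z ⟩ + ⟨ y , z ⟩
      ⟨⟩-scalar   : ∀ a x z → ⟨ a · x , z ⟩ ≡ a * ⟨ x , z ⟩

  Nondegenerate : Set c
  Nondegenerate = ∀ x → (∀ y → ⟨ x , y ⟩ ≡ 0#) → x ≡ 𝟎

  -- A sphere is its parameter pair (center , radius), not its set of points.
  Sphere : Set c
  Sphere = Point × Carrier

  center : Sphere → Point
  center = proj₁

  radius : Sphere → Carrier
  radius = proj₂

  _≟ₛ_ : DecidableEquality Sphere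
  _≟ₛ_ = ×-≡-dec (Vec-≡-dec _≟_) _≟_

  infix 4 _∈ₛ_ _∈ₛ?_ _∈H⟨_,_⟩

  _∈ₛ_ : Point → Sphere → Set c
  x ∈ₛ S = Q (x ⊖ center S) ≡ radius S

  _∈ₛ?_ : ∀ x S → Dec (x ∈ₛ S)
  x ∈ₛ? S = Q (x ⊖ center S) ≟ radius S

  -- The radical hyperplane; meaningful only when the centers differ.
  _∈H⟨_,_⟩ : Point → Sphere → Sphere → Set c
  x ∈H⟨ S , S′ ⟩ =
    2# * ⟨ center S′ ⊖ center S , x ⟩
      ≡ ((radius S - radius S′) - Q (center S)) + Q (center S′)

  ∈H? : ∀ S S′ x → Dec (x ∈H⟨ S , S′ ⟩)
  ∈H? S S′ x = _ ≟ _

  -- Finite sets of points and of spheres are duplicate-free lists.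

  #incidences : List Point → List Sphere → ℕ
  #incidences P 𝒮 = count (λ (p , S) → p ∈ₛ? S) (cartesianProduct P 𝒮)

  ∣_∩_∩_∣ : List Point → Sphere → Sphere → ℕ
  ∣ P ∩ S ∩ S′ ∣ = count (λ p → (p ∈ₛ? S) ×-dec (p ∈ₛ? S′)) P

  ∣_∩H⟨_,_⟩∣ : List Point → Sphere → Sphere → ℕ
  ∣ P ∩H⟨ S , S′ ⟩∣ = count (∈H? S S′) P

  module Over {r ℓ₁ ℓ₂} (ℝ : EuclideanField r ℓ₁ ℓ₂) where
    private module ℝ = EuclideanField ℝ
    open ℝ using (ι)

    σ : List Point → List Sphere → ℝ.Carrier
    σ P 𝒮 = ι (#incidences P 𝒮) ℝ.- (ι (length P) ℝ.* ι (length 𝒮)) ℝ./ ι q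

    module Witnessing (P : List Point) (𝒮 : List Sphere) (K : ℝ.Carrier) where

      threshold : ℝ.Carrier
      threshold = ((K ℝ.* K) ℝ.* ι (q ℕ.^ (d ℕ.∸ 1))) ℝ./ (ι 4 ℝ.* ι (length 𝒮))

      Rich : Sphere → Sphere → Set ℓ₂
      Rich S S′ = threshold ℝ.≤ ι ∣ P ∩ S ∩ S′ ∣

      Witness : Sphere → Sphere → Set (c ⊔ ℓ₂)
      Witness S S′ = S ≢ S′ × Rich S S′

      witness? : ∀ S S′ → Dec (Witness S S′)
      witness? S S′ = ¬? (S ≟ₛ S′) ×-dec (threshold ℝ.≤? ι ∣ P ∩ S ∩ S′ ∣)

      #pairs : ℕ
      #pairs = count (λ (S , S′) → witness? S S′) (cartesianProduct 𝒮 𝒮)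

      #partners : Sphere → ℕ
      #partners S = count (witness? S) 𝒮

      #spheresWithPartners≥ : ℝ.Carrier → ℕ
      #spheresWithPartners≥ t = count (λ S → t ℝ.≤? ι (#partners S)) 𝒮

{-# OPTIONS --safe #-}
-- Let f(p) be the number of spheres through p ∈ P and I = Σ f(p).  Since σ ≤ I, the first hypothesis gives
-- I² ≥ K² q^(d-1) |P| |𝒮|, and with the second one I ≥ 2 |P|.  Cauchy–Schwarz applied to f then shows that
-- Σ |P ∩ S ∩ S′| over S ≠ S′ is at least I² / (2 |P|) ≥ K² q^(d-1) |𝒮| / 2.  Pairs below the threshold
-- contribute at most half of this, and each remaining pair contributes at most max |S ∩ S′|, which is
-- q^(d-1) (a hyperplane) or, for d ≥ 3, 2 q^(d-2) (a quadric in a hyperplane: Q cannot vanish on v^⊥).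
-- Averaging the number of partners over 𝒮 gives the spheres with many partners.
module Submission where

open import Defs
open import Algebra.Bundles using (CommutativeRing)
import Algebra.Properties.Ring as RingProperties
import Algebra.Solver.Ring.NaturalCoefficients.Default as SemiringSolver
open import Data.Bool.Base using (if_then_else_; true; false)
import Data.Fin.Base as Fin
import Data.Fin.Properties as Fin
open import Data.List.Base as List using (List; []; _∷_; _++_; length; filter; map; cartesianProduct; cartesianProductWith; allFin)
open import Data.List.Membership.Propositional using (_∈_; find; lose)
open import Data.List.Membership.Propositional.Properties
open import Data.List.Properties using (length-++; length-map; length-tabulate; length-filter; filter-none)
open import Data.List.Relation.Unary.All as All using ([]; _∷_)
open import Data.List.Relation.Unary.AllPairs using ([]; _∷_)
open import Data.List.Relation.Unary.Any using (here; there; any?)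
open import Data.List.Relation.Unary.Unique.Propositional using (Unique)
import Data.List.Relation.Unary.Unique.Propositional.Properties as Unique
open import Data.Nat.Base as ℕ using (ℕ; zero; suc; z≤n; s≤s)
open import Data.Nat.Divisibility using (_∤_; divides)
import Data.Nat.Properties as ℕ
open import Data.Nat.Solver using (module +-*-Solver)
open import Data.Product using (_×_; _,_; proj₁; proj₂; ∃)
open import Data.Product.Properties using (,-injective) renaming (≡-dec to ×-≡-dec)
open import Data.Sum.Base using (_⊎_; inj₁; inj₂)
open import Data.Vec.Base as Vec using (Vec; []; _∷_; replicate)
open import Data.Vec.Properties using (∷-injective; zipWith-comm; zipWith-assoc) renaming (≡-dec to Vec-≡-dec)
open import Function.Base using (_∘_; id)
open import Function.Bundles using (module Inverse)
open import Relation.Binary.Bundles using (Poset)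
open import Relation.Binary.Definitions using (DecidableEquality)
open import Relation.Binary.PropositionalEquality as ≡ using (_≡_; _≢_)
import Relation.Binary.Reasoning.PartialOrder as PosetReasoning
open import Relation.Binary.Structures using (IsDecTotalOrder)
open import Relation.Nullary using (¬_; Dec; _because_; does; yes; no; contradiction; ¬?; _×-dec_; decidable-stable)
open import Relation.Unary using (Pred; Decidable)

-- Subspaces and dimensions are avoided: a set of points in a hyperplane is bounded by translating
-- it along one or two directions and showing that the resulting map into 𝔽^d is injective, or at
-- most two-to-one, so that only lengths of lists are compared. The delicate point is the sharper
-- bound: if `Q` vanished on v^⊥, the sphere equation would be affine on the radical hyperplane and
-- could hold on all of it. For d = 2 this does occur, as v^⊥ may be an isotropic line; for d ≥ 3
-- nondegeneracy excludes it.
--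
-- The constants: write T for the threshold, e = q^(d-1), n = |𝒮|. The n² ordered pairs, each at
-- value T, weigh n² T = K² e n / 4, so the rich pairs carry at least K² e n / 4. Dividing by M = e
-- leaves K² n / 4, dividing by M = 2 q^(d-2) leaves K² q n / 8, and averaging over 𝒮 costs one more
-- factor 2. Positivity of T, hence of K, is what excludes concentric pairs.

module Counting where

  -- Finite sums, indicators and double counting over lists.

  open import Data.Nat.Base using (_+_; _*_; _≤_)
  open import Data.Nat.Properties
  open ≡

  -- Depends only on the boolean of the decision, so indicators of conjunctions and negations
  -- compute without looking at proofs.
  𝟙 : ∀ {p} {P : Set p} → Dec P → ℕ
  𝟙 P? = if does P? then 1 else 0

  𝟙-×-dec : ∀ {p q} {P : Set p} {Q : Set q} (P? : Dec P) (Q? : Dec Q) → 𝟙 (P? ×-dec Q?) ≡ 𝟙 P? * 𝟙 Q?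
  𝟙-×-dec (true  because _) Q? = sym (*-identityˡ _)
  𝟙-×-dec (false because _) Q? = refl

  𝟙+𝟙¬ : ∀ {p} {P : Set p} (P? : Dec P) → 𝟙 P? + 𝟙 (¬? P?) ≡ 1
  𝟙+𝟙¬ (true  because _) = refl
  𝟙+𝟙¬ (false because _) = refl

  𝟙≤1 : ∀ {p} {P : Set p} (P? : Dec P) → 𝟙 P? ≤ 1
  𝟙≤1 (true  because _) = ≤-refl
  𝟙≤1 (false because _) = z≤n

  𝟙-idem : ∀ {p} {P : Set p} (P? : Dec P) → 𝟙 P? * 𝟙 P? ≡ 𝟙 P?
  𝟙-idem (true  because _) = refl
  𝟙-idem (false because _) = refl

  𝟙-true : ∀ {p} {P : Set p} (P? : Dec P) → P → 𝟙 P? ≡ 1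
  𝟙-true (yes _) _ = refl
  𝟙-true (no ¬p) p = contradiction p ¬p

  ∑ : ∀ {a} {A : Set a} → List A → (A → ℕ) → ℕ
  ∑ []       f = 0
  ∑ (x ∷ xs) f = f x + ∑ xs f

  syntax ∑ xs (λ x → e) = ∑[ x ∈ xs ] e

  module _ {a} {A : Set a} where

    ∑-cong : ∀ xs {f g : A → ℕ} → (∀ x → f x ≡ g x) → ∑ xs f ≡ ∑ xs g
    ∑-cong []       f≗g = refl
    ∑-cong (x ∷ xs) f≗g = cong₂ _+_ (f≗g x) (∑-cong xs f≗g)

    ∑-mono-∈ : ∀ xs {f g : A → ℕ} → (∀ {x} → x ∈ xs → f x ≤ g x) → ∑ xs f ≤ ∑ xs g
    ∑-mono-∈ []       f≤g = z≤n
    ∑-mono-∈ (x ∷ xs) f≤g = +-mono-≤ (f≤g (here refl)) (∑-mono-∈ xs (f≤g ∘ there))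

    ∑-mono : ∀ xs {f g : A → ℕ} → (∀ x → f x ≤ g x) → ∑ xs f ≤ ∑ xs g
    ∑-mono xs f≤g = ∑-mono-∈ xs (λ {x} _ → f≤g x)

    ∑-+ : ∀ xs (f g : A → ℕ) → ∑[ x ∈ xs ] (f x + g x) ≡ ∑ xs f + ∑ xs g
    ∑-+ []       f g = refl
    ∑-+ (x ∷ xs) f g = trans (cong (f x + g x +_) (∑-+ xs f g))
      (solve 4 (λ a b c d → a :+ b :+ (c :+ d) := a :+ c :+ (b :+ d)) refl (f x) (g x) (∑ xs f) (∑ xs g))
      where open +-*-Solver

    ∑-*ˡ : ∀ xs k (f : A → ℕ) → ∑[ x ∈ xs ] (k * f x) ≡ k * ∑ xs f
    ∑-*ˡ []       k f = sym (*-zeroʳ k)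
    ∑-*ˡ (x ∷ xs) k f = trans (cong (k * f x +_) (∑-*ˡ xs k f)) (sym (*-distribˡ-+ k (f x) (∑ xs f)))

    ∑-*ʳ : ∀ xs k (f : A → ℕ) → ∑[ x ∈ xs ] (f x * k) ≡ ∑ xs f * k
    ∑-*ʳ xs k f = trans (∑-cong xs (λ x → *-comm (f x) k)) (trans (∑-*ˡ xs k f) (*-comm k (∑ xs f)))

    ∑-const : ∀ (xs : List A) k → ∑[ x ∈ xs ] k ≡ length xs * k
    ∑-const []       k = refl
    ∑-const (x ∷ xs) k = cong (k +_) (∑-const xs k)

    ∑-++ : ∀ xs ys (f : A → ℕ) → ∑ (xs ++ ys) f ≡ ∑ xs f + ∑ ys f
    ∑-++ []       ys f = refl
    ∑-++ (x ∷ xs) ys f = trans (cong (f x +_) (∑-++ xs ys f)) (sym (+-assoc (f x) _ _))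

    count≡∑ : ∀ {p} {P : Pred A p} (P? : Decidable P) xs → count P? xs ≡ ∑[ x ∈ xs ] 𝟙 (P? x)
    count≡∑ P? []       = refl
    count≡∑ P? (x ∷ xs) with does (P? x)
    ... | true  = cong suc (count≡∑ P? xs)
    ... | false = count≡∑ P? xs

    count-⊆ : ∀ {p q} {P : Pred A p} {Q : Pred A q} (P? : Decidable P) (Q? : Decidable Q) xs →
              (∀ {x} → P x → Q x) → count P? xs ≤ count Q? xs
    count-⊆ P? Q? xs P⊆Q rewrite count≡∑ P? xs | count≡∑ Q? xs = ∑-mono xs 𝟙-mono
      where
      𝟙-mono : ∀ x → 𝟙 (P? x) ≤ 𝟙 (Q? x)
      𝟙-mono x with P? x
      ... | yes Px = ≤-reflexive (sym (𝟙-true (Q? x) (P⊆Q Px)))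
      ... | no  _  = z≤n

    count+count¬ : ∀ {p} {P : Pred A p} (P? : Decidable P) xs → count P? xs + count (¬? ∘ P?) xs ≡ length xs
    count+count¬ P? xs = begin
      count P? xs + count (¬? ∘ P?) xs                      ≡⟨ cong₂ _+_ (count≡∑ P? xs) (count≡∑ (¬? ∘ P?) xs) ⟩
      ∑ xs (𝟙 ∘ P?) + ∑ xs (𝟙 ∘ ¬? ∘ P?)                    ≡⟨ ∑-+ xs _ _ ⟨
      ∑[ x ∈ xs ] (𝟙 (P? x) + 𝟙 (¬? (P? x)))                ≡⟨ ∑-cong xs (𝟙+𝟙¬ ∘ P?) ⟩
      ∑[ x ∈ xs ] 1                                         ≡⟨ ∑-const xs 1 ⟩
      length xs * 1                                         ≡⟨ *-identityʳ _ ⟩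
      length xs                                             ∎
      where open ≡-Reasoning

    -- Cauchy-Schwarz against the constant function 1. The induction splits off one entry; its cross
    -- terms with the remaining entries are bounded one by one by 2ab ≤ a² + b².
    ∑-square : ∀ xs (f : A → ℕ) → ∑ xs f * ∑ xs f ≤ length xs * ∑[ x ∈ xs ] (f x * f x)
    ∑-square []       f = z≤n
    ∑-square (x ∷ xs) f = begin
      (f x + s) * (f x + s)                                 ≡⟨ solve 2 (λ y s → (y :+ s) :* (y :+ s) := y :* y :+ con 2 :* y :* s :+ s :* s) refl (f x) s ⟩
      f x * f x + 2 * f x * s + s * s                       ≤⟨ +-mono-≤ (+-monoʳ-≤ (f x * f x) (cross xs)) (∑-square xs f) ⟩
      f x * f x + (n * (f x * f x) + t) + n * t             ≡⟨ solve 3 (λ y n t → y :+ (n :* y :+ t) :+ n :* t := (con 1 :+ n) :* (y :+ t)) refl (f x * f x) n t ⟩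
      suc n * (f x * f x + t)                               ∎
      where
      open ≤-Reasoning
      open +-*-Solver
      n = length xs
      s = ∑ xs f
      t = ∑[ y ∈ xs ] (f y * f y)

      -- Subtraction-free form of (a - b)² ≥ 0: raising both arguments by one adds 2 (1 + a + b) to
      -- either side, so the claim descends to the case where one argument is zero.
      2ab≤a²+b² : ∀ a b → 2 * a * b ≤ a * a + b * b
      2ab≤a²+b² zero    b       = z≤n
      2ab≤a²+b² (suc a) zero    = ≤-trans (≤-reflexive (*-zeroʳ (2 * suc a))) z≤n
      2ab≤a²+b² (suc a) (suc b) = begin
        2 * suc a * suc b                                   ≡⟨ solve 2 (λ a b → con 2 :* (con 1 :+ a) :* (con 1 :+ b) := con 2 :* a :* b :+ con 2 :* (con 1 :+ a :+ b)) refl a b ⟩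
        2 * a * b + 2 * (1 + a + b)                         ≤⟨ +-monoˡ-≤ _ (2ab≤a²+b² a b) ⟩
        a * a + b * b + 2 * (1 + a + b)                     ≡⟨ solve 2 (λ a b → a :* a :+ b :* b :+ con 2 :* (con 1 :+ a :+ b) := (con 1 :+ a) :* (con 1 :+ a) :+ (con 1 :+ b) :* (con 1 :+ b)) refl a b ⟩
        suc a * suc a + suc b * suc b                       ∎

      cross : ∀ ys → 2 * f x * ∑ ys f ≤ length ys * (f x * f x) + ∑[ y ∈ ys ] (f y * f y)
      cross []       = ≤-reflexive (*-zeroʳ (2 * f x))
      cross (y ∷ ys) = begin
        2 * f x * (f y + ∑ ys f)                            ≡⟨ *-distribˡ-+ (2 * f x) (f y) _ ⟩
        2 * f x * f y + 2 * f x * ∑ ys f                    ≤⟨ +-mono-≤ (2ab≤a²+b² (f x) (f y)) (cross ys) ⟩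
        f x * f x + f y * f y + (length ys * (f x * f x) + ∑[ z ∈ ys ] (f z * f z))
          ≡⟨ solve 4 (λ a b c d → a :+ b :+ (c :+ d) := (a :+ c) :+ (b :+ d)) refl (f x * f x) (f y * f y) _ _ ⟩
        f x * f x + length ys * (f x * f x) + (f y * f y + ∑[ z ∈ ys ] (f z * f z)) ∎

    -- Uniqueness lets at most one term survive. Only an upper bound holds, since `y` need not occur
    -- in `xs`.
    ∑-diagonal-≤ : (_≟_ : DecidableEquality A) (f : A → ℕ) (y : A) → ∀ {xs} → Unique xs →
                   ∑[ x ∈ xs ] (𝟙 (y ≟ x) * f x) ≤ f y
    ∑-diagonal-≤ _≟_ f y []                       = z≤n
    ∑-diagonal-≤ _≟_ f y {x ∷ xs} (x∉xs ∷ uniq) with y ≟ x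
    ... | no  _    = ∑-diagonal-≤ _≟_ f y uniq
    ... | yes refl = ≤-reflexive (trans (cong₂ _+_ (*-identityˡ (f x)) (vanish x∉xs)) (+-identityʳ (f x)))
      where
      vanish : ∀ {zs} → All.All (x ≢_) zs → ∑[ z ∈ zs ] (𝟙 (x ≟ z) * f z) ≡ 0
      vanish []                   = refl
      vanish {z ∷ zs} (x≢z ∷ x∉zs) with x ≟ z
      ... | yes x≡z = contradiction x≡z x≢z
      ... | no  _   = vanish x∉zs

    unique-length≤1 : ∀ {xs : List A} → Unique xs → (∀ {x y} → x ∈ xs → y ∈ xs → x ≡ y) → length xs ≤ 1
    unique-length≤1 {[]}         _                  _  = z≤n
    unique-length≤1 {_ ∷ []}     _                  _  = ≤-refl
    unique-length≤1 {_ ∷ _ ∷ _} ((x≢y ∷ _) ∷ _)     eq = contradiction (eq (here refl) (there (here refl))) x≢y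

    -- The hypothesis has the form in which "a quadratic equation has at most two roots" becomes
    -- available: among any three solutions two coincide.
    unique-length≤2 : ∀ {xs : List A} → Unique xs →
                      (∀ {x y z} → x ∈ xs → y ∈ xs → z ∈ xs → x ≡ y ⊎ x ≡ z ⊎ y ≡ z) → length xs ≤ 2
    unique-length≤2 {[]}             _ _ = z≤n
    unique-length≤2 {_ ∷ []}         _ _ = s≤s z≤n
    unique-length≤2 {_ ∷ _ ∷ []}     _ _ = ≤-refl
    unique-length≤2 {_ ∷ _ ∷ _ ∷ _} ((x≢y ∷ x≢z ∷ _) ∷ (y≢z ∷ _) ∷ _) eq
      with eq (here refl) (there (here refl)) (there (there (here refl)))
    ... | inj₁ x≡y        = contradiction x≡y x≢y
    ... | inj₂ (inj₁ x≡z) = contradiction x≡z x≢z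
    ... | inj₂ (inj₂ y≡z) = contradiction y≡z y≢z

  module _ {a b} {A : Set a} {B : Set b} where

    ∑-swap : ∀ xs ys (f : A → B → ℕ) → ∑[ x ∈ xs ] (∑[ y ∈ ys ] f x y) ≡ ∑[ y ∈ ys ] (∑[ x ∈ xs ] f x y)
    ∑-swap []       ys f = sym (trans (∑-const ys 0) (*-zeroʳ (length ys)))
    ∑-swap (x ∷ xs) ys f = trans (cong (∑ ys (f x) +_) (∑-swap xs ys f)) (sym (∑-+ ys (f x) _))

    ∑-map : ∀ (g : A → B) xs (f : B → ℕ) → ∑ (map g xs) f ≡ ∑ xs (f ∘ g)
    ∑-map g []       f = refl
    ∑-map g (x ∷ xs) f = cong (f (g x) +_) (∑-map g xs f)

    ∑-*-∑ : ∀ xs ys (f : A → ℕ) (g : B → ℕ) → ∑[ x ∈ xs ] (∑[ y ∈ ys ] (f x * g y)) ≡ ∑ xs f * ∑ ys g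
    ∑-*-∑ xs ys f g = trans (∑-cong xs (λ x → ∑-*ˡ ys (f x) g)) (∑-*ʳ xs (∑ ys g) f)

    -- Double counting of the pairs (x , y) with `g x ≡ y`: each x lies in at least one pair, each y
    -- in at most `k`.
    length≤fibre*length : (_≟_ : DecidableEquality B) (g : A → B) → ∀ k {xs ys} →
                          (∀ {x} → x ∈ xs → g x ∈ ys) →
                          (∀ y → count (λ x → g x ≟ y) xs ≤ k) → length xs ≤ k * length ys
    length≤fibre*length _≟_ g k {xs} {ys} g∈ys fibre≤k = begin
      length xs                                             ≡⟨ *-identityʳ _ ⟨
      length xs * 1                                         ≡⟨ ∑-const xs 1 ⟨
      ∑[ x ∈ xs ] 1                                         ≤⟨ ∑-mono-∈ xs (hit ∘ g∈ys) ⟩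
      ∑[ x ∈ xs ] (∑[ y ∈ ys ] 𝟙 (g x ≟ y))                 ≡⟨ ∑-swap xs ys _ ⟩
      ∑[ y ∈ ys ] (∑[ x ∈ xs ] 𝟙 (g x ≟ y))                 ≡⟨ ∑-cong ys (λ y → sym (count≡∑ (λ x → g x ≟ y) xs)) ⟩
      ∑[ y ∈ ys ] count (λ x → g x ≟ y) xs                  ≤⟨ ∑-mono ys fibre≤k ⟩
      ∑[ y ∈ ys ] k                                         ≡⟨ ∑-const ys k ⟩
      length ys * k                                         ≡⟨ *-comm (length ys) k ⟩
      k * length ys                                         ∎
      where
      open ≤-Reasoning

      hit : ∀ {z zs} → z ∈ zs → 1 ≤ ∑[ y ∈ zs ] 𝟙 (z ≟ y)
      hit {z} (here refl) = ≤-trans (≤-reflexive (sym (𝟙-true (z ≟ z) refl))) (m≤m+n _ _)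
      hit     (there z∈)  = ≤-trans (hit z∈) (m≤n+m _ _)

    injection⇒length≤ : (_≟_ : DecidableEquality B) (g : A → B) → ∀ {xs ys} → Unique xs →
                        (∀ {x} → x ∈ xs → g x ∈ ys) →
                        (∀ {x x′} → x ∈ xs → x′ ∈ xs → g x ≡ g x′ → x ≡ x′) → length xs ≤ length ys
    injection⇒length≤ _≟_ g {xs} {ys} uniq g∈ys inj =
      subst (length xs ≤_) (*-identityˡ _) (length≤fibre*length _≟_ g 1 g∈ys λ y →
        unique-length≤1 (Unique.filter⁺ (λ x → g x ≟ y) uniq) λ x∈ x′∈ →
          let x∈xs  , gx≡y  = ∈-filter⁻ (λ x → g x ≟ y) x∈
              x′∈xs , gx′≡y = ∈-filter⁻ (λ x → g x ≟ y) x′∈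
          in inj x∈xs x′∈xs (trans gx≡y (sym gx′≡y)))

  ∑-cartesianProduct : ∀ {a b} {A : Set a} {B : Set b} (xs : List A) (ys : List B) (f : A × B → ℕ) →
                       ∑ (cartesianProduct xs ys) f ≡ ∑[ x ∈ xs ] (∑[ y ∈ ys ] f (x , y))
  ∑-cartesianProduct []       ys f = refl
  ∑-cartesianProduct (x ∷ xs) ys f = trans (∑-++ (map (x ,_) ys) _ f)
    (cong₂ _+_ (∑-map (x ,_) ys f) (∑-cartesianProduct xs ys f))

  length-cartesianProductWith : ∀ {a b c} {A : Set a} {B : Set b} {C : Set c} (f : A → B → C) xs ys →
                                length (cartesianProductWith f xs ys) ≡ length xs * length ys
  length-cartesianProductWith f []       ys = refl
  length-cartesianProductWith f (x ∷ xs) ys = trans (length-++ (map (f x) ys))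
    (cong₂ _+_ (length-map (f x) ys) (length-cartesianProductWith f xs ys))

  -- Second moment of an incidence relation.

  module _ {a b r} {A : Set a} {B : Set b} {R : A → B → Set r} (R? : ∀ x y → Dec (R x y))
           (_≟_ : DecidableEquality B) (xs : List A) {ys : List B} (ys! : Unique ys) where

    private
      incidences : ℕ
      incidences = count (λ (x , y) → R? x y) (cartesianProduct xs ys)

      common : B → B → ℕ
      common y y′ = count (λ x → R? x y ×-dec R? x y′) xs

      degree : A → ℕ
      degree x = ∑[ y ∈ ys ] 𝟙 (R? x y)

    -- The diagonal is removed by an indicator factor and not by filtering, so that the sum runs
    -- over the full product list, the same one over which rich pairs are counted.
    offDiagonal : B × B → ℕ
    offDiagonal (y , y′) = 𝟙 (¬? (y ≟ y′)) * common y y′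

    private
      incidences≡∑degree : incidences ≡ ∑ xs degree
      incidences≡∑degree = trans (count≡∑ _ (cartesianProduct xs ys)) (∑-cartesianProduct xs ys _)

      common≡∑ : ∀ y y′ → common y y′ ≡ ∑[ x ∈ xs ] (𝟙 (R? x y) * 𝟙 (R? x y′))
      common≡∑ y y′ = trans (count≡∑ _ xs) (∑-cong xs (λ x → 𝟙-×-dec (R? x y) (R? x y′)))

      -- Both sides count triples (x , y , y′) with x related to y and to y′.
      ∑degree²≡∑common : ∑[ x ∈ xs ] (degree x * degree x) ≡ ∑[ y ∈ ys ] (∑[ y′ ∈ ys ] common y y′)
      ∑degree²≡∑common = begin
        ∑[ x ∈ xs ] (degree x * degree x)                                               ≡⟨ ∑-cong xs (λ x → ∑-*-∑ ys ys _ _) ⟨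
        ∑[ x ∈ xs ] (∑[ y ∈ ys ] (∑[ y′ ∈ ys ] (𝟙 (R? x y) * 𝟙 (R? x y′))))             ≡⟨ ∑-swap xs ys _ ⟩
        ∑[ y ∈ ys ] (∑[ x ∈ xs ] (∑[ y′ ∈ ys ] (𝟙 (R? x y) * 𝟙 (R? x y′))))             ≡⟨ ∑-cong ys (λ y → ∑-swap xs ys _) ⟩
        ∑[ y ∈ ys ] (∑[ y′ ∈ ys ] (∑[ x ∈ xs ] (𝟙 (R? x y) * 𝟙 (R? x y′))))             ≡⟨ ∑-cong ys (λ y → ∑-cong ys (λ y′ → common≡∑ y y′)) ⟨
        ∑[ y ∈ ys ] (∑[ y′ ∈ ys ] common y y′)                                          ∎
        where open ≡-Reasoning

      split-diagonal : ∀ y y′ → common y y′ ≡ 𝟙 (y ≟ y′) * common y y′ + offDiagonal (y , y′)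
      split-diagonal y y′ = sym (trans (sym (*-distribʳ-+ (common y y′) (𝟙 (y ≟ y′)) _))
        (trans (cong (_* common y y′) (𝟙+𝟙¬ (y ≟ y′))) (*-identityˡ _)))

      common-self : ∀ y → common y y ≡ ∑[ x ∈ xs ] 𝟙 (R? x y)
      common-self y = trans (common≡∑ y y) (∑-cong xs (λ x → 𝟙-idem (R? x y)))

      -- A diagonal term is the number of x related to y, so the diagonal sums back to `incidences`.
      ∑common≤ : ∑[ y ∈ ys ] (∑[ y′ ∈ ys ] common y y′) ≤ incidences + ∑ (cartesianProduct ys ys) offDiagonal
      ∑common≤ = begin
        ∑[ y ∈ ys ] (∑[ y′ ∈ ys ] common y y′)
          ≡⟨ ∑-cong ys (λ y → trans (∑-cong ys (split-diagonal y)) (∑-+ ys _ _)) ⟩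
        ∑[ y ∈ ys ] (∑[ y′ ∈ ys ] (𝟙 (y ≟ y′) * common y y′) + ∑[ y′ ∈ ys ] offDiagonal (y , y′))
          ≡⟨ ∑-+ ys _ _ ⟩
        ∑[ y ∈ ys ] (∑[ y′ ∈ ys ] (𝟙 (y ≟ y′) * common y y′)) + ∑[ y ∈ ys ] (∑[ y′ ∈ ys ] offDiagonal (y , y′))
          ≤⟨ +-mono-≤ (∑-mono ys (λ y → ∑-diagonal-≤ _≟_ (common y) y ys!)) (≤-reflexive (sym (∑-cartesianProduct ys ys offDiagonal))) ⟩
        ∑[ y ∈ ys ] common y y + ∑ (cartesianProduct ys ys) offDiagonal
          ≡⟨ cong (_+ ∑ (cartesianProduct ys ys) offDiagonal) (trans (∑-cong ys common-self) (trans (∑-swap ys xs _) (sym incidences≡∑degree))) ⟩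
        incidences + ∑ (cartesianProduct ys ys) offDiagonal ∎
        where open ≤-Reasoning

    incidences²≤ : incidences * incidences ≤ length xs * (incidences + ∑ (cartesianProduct ys ys) offDiagonal)
    incidences²≤ = begin
      incidences * incidences                           ≡⟨ cong₂ _*_ incidences≡∑degree incidences≡∑degree ⟩
      ∑ xs degree * ∑ xs degree                         ≤⟨ ∑-square xs degree ⟩
      length xs * ∑[ x ∈ xs ] (degree x * degree x)     ≡⟨ cong (length xs *_) ∑degree²≡∑common ⟩
      length xs * ∑[ y ∈ ys ] (∑[ y′ ∈ ys ] common y y′) ≤⟨ *-monoʳ-≤ (length xs) ∑common≤ ⟩
      length xs * (incidences + ∑ (cartesianProduct ys ys) offDiagonal) ∎
      where open ≤-Reasoning

    -- When incidences ≥ 2 |xs|, the diagonal accounts for at most half of the second moment.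
    incidences²≤2*offDiagonal : 2 * length xs ≤ incidences →
      incidences * incidences ≤ 2 * (length xs * ∑ (cartesianProduct ys ys) offDiagonal)
    incidences²≤2*offDiagonal 2m≤I = +-cancelˡ-≤ (I * I) _ _ (begin
      I * I + I * I                 ≤⟨ +-mono-≤ incidences²≤ incidences²≤ ⟩
      m * (I + D) + m * (I + D)     ≡⟨ solve 3 (λ m I D → m :* (I :+ D) :+ m :* (I :+ D) := con 2 :* m :* I :+ con 2 :* (m :* D)) refl m I D ⟩
      2 * m * I + 2 * (m * D)       ≤⟨ +-monoˡ-≤ _ (*-monoˡ-≤ I 2m≤I) ⟩
      I * I + 2 * (m * D)           ∎)
      where
      open ≤-Reasoning
      open +-*-Solver
      m = length xs
      I = incidences
      D = ∑ (cartesianProduct ys ys) offDiagonal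

open Counting

-- Inequalities in an ordered field, the embedding of ℕ, and averaging.

module OrderedField {a ℓ₁ ℓ₂} (ℝ : EuclideanField a ℓ₁ ℓ₂) where

  open EuclideanField ℝ
  open IsDecTotalOrder isDecTotalOrder public using (isPartialOrder; total; ≤-respˡ-≈; ≤-respʳ-≈)
    renaming (refl to ≤-refl; trans to ≤-trans; antisym to ≤-antisym; reflexive to ≤-reflexive)

  commutativeRing : CommutativeRing a ℓ₁
  commutativeRing = record { isCommutativeRing = isCommutativeRing }

  open CommutativeRing commutativeRing public using (ring; commutativeSemiring; refl; sym; trans)
  open RingProperties ring using (-1*x≈-x; -‿involutive)

  poset : Poset a ℓ₁ ℓ₂
  poset = record { isPartialOrder = isPartialOrder }

  module ≤-Reasoning = PosetReasoning poset
  open SemiringSolver commutativeSemiring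

  +-mono-≤ : ∀ {x y u v} → x ≤ y → u ≤ v → x + u ≤ y + v
  +-mono-≤ {x} {y} {u} {v} x≤y u≤v = begin
    x + u ≤⟨ +-monoʳ-≤ x u≤v ⟩
    x + v ≈⟨ +-comm x v ⟩
    v + x ≤⟨ +-monoʳ-≤ v x≤y ⟩
    v + y ≈⟨ +-comm v y ⟩
    y + v ∎
    where open ≤-Reasoning

  +-cancelˡ-≤ : ∀ x {y z} → x + y ≤ x + z → y ≤ z
  +-cancelˡ-≤ x {y} {z} x+y≤x+z = begin
    y               ≈⟨ cancel y ⟩
    - x + (x + y)   ≤⟨ +-monoʳ-≤ (- x) x+y≤x+z ⟩
    - x + (x + z)   ≈⟨ cancel z ⟨
    z               ∎
    where
    open ≤-Reasoning
    cancel : ∀ w → w ≈ - x + (x + w)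
    cancel w = sym (trans (sym (+-assoc (- x) x w)) (trans (+-congʳ (-‿inverseˡ x)) (+-identityˡ w)))

  x≤y⇒0≤y-x : ∀ {x y} → x ≤ y → 0# ≤ y - x
  x≤y⇒0≤y-x {x} {y} x≤y = ≤-respˡ-≈ (-‿inverseʳ x) (+-mono-≤ x≤y ≤-refl)

  0≤y⇒x-y≤x : ∀ {y z} → 0# ≤ z → y - z ≤ y
  0≤y⇒x-y≤x {y} {z} 0≤z = begin
    y - z         ≈⟨ +-identityˡ (y - z) ⟨
    0# + (y - z)  ≤⟨ +-mono-≤ 0≤z ≤-refl ⟩
    z + (y - z)   ≈⟨ solve 3 (λ y z w → z :+ (y :+ w) := y :+ (z :+ w)) refl y z (- z) ⟩
    y + (z - z)   ≈⟨ +-congˡ (-‿inverseʳ z) ⟩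
    y + 0#        ≈⟨ +-identityʳ y ⟩
    y             ∎
    where open ≤-Reasoning

  *-monoˡ-≤ : ∀ {x y z} → 0# ≤ x → y ≤ z → x * y ≤ x * z
  *-monoˡ-≤ {x} {y} {z} 0≤x y≤z = begin
    x * y                     ≈⟨ +-identityʳ (x * y) ⟨
    x * y + 0#                ≤⟨ +-monoʳ-≤ (x * y) (*-nonNeg 0≤x (x≤y⇒0≤y-x y≤z)) ⟩
    x * y + x * (z - y)       ≈⟨ solve 4 (λ x y z w → x :* y :+ x :* (z :+ w) := x :* (z :+ (y :+ w))) refl x y z (- y) ⟩
    x * (z + (y - y))         ≈⟨ *-congˡ (trans (+-congˡ (-‿inverseʳ y)) (+-identityʳ z)) ⟩
    x * z                     ∎
    where open ≤-Reasoning

  *-mono-≤ : ∀ {x y u v} → 0# ≤ y → 0# ≤ u → x ≤ y → u ≤ v → x * u ≤ y * v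
  *-mono-≤ {x} {y} {u} {v} 0≤y 0≤u x≤y u≤v = begin
    x * u ≈⟨ *-comm x u ⟩
    u * x ≤⟨ *-monoˡ-≤ 0≤u x≤y ⟩
    u * y ≈⟨ *-comm u y ⟩
    y * u ≤⟨ *-monoˡ-≤ 0≤y u≤v ⟩
    y * v ∎
    where open ≤-Reasoning

  0≤1 : 0# ≤ 1#
  0≤1 with total 0# 1#
  ... | inj₁ 0≤1 = 0≤1
  ... | inj₂ 1≤0 = ≤-respʳ-≈ (trans (-1*x≈-x (- 1#)) (-‿involutive 1#)) (*-nonNeg 0≤-1 0≤-1)
    where
    0≤-1 : 0# ≤ - 1#
    0≤-1 = ≤-respʳ-≈ (+-identityˡ (- 1#)) (x≤y⇒0≤y-x 1≤0)

  *-cancelˡ-≈ : ∀ {x y z} → ¬ (x ≈ 0#) → x * y ≈ x * z → y ≈ z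
  *-cancelˡ-≈ {x} {y} {z} x≉0 xy≈xz = trans (cancel y) (trans (*-congˡ xy≈xz) (sym (cancel z)))
    where
    cancel : ∀ w → w ≈ x ⁻¹ * (x * w)
    cancel w = sym (trans (solve 3 (λ i x w → i :* (x :* w) := x :* i :* w) refl (x ⁻¹) x w)
                          (trans (*-congʳ (⁻¹-inverseʳ x x≉0)) (*-identityˡ w)))

  *-nonzero : ∀ {x y} → ¬ (x ≈ 0#) → ¬ (y ≈ 0#) → ¬ (x * y ≈ 0#)
  *-nonzero {x} x≉0 y≉0 xy≈0 = y≉0 (*-cancelˡ-≈ x≉0 (trans xy≈0 (sym (zeroʳ x))))

  *-pos : ∀ {x y} → 0# < x → 0# < y → 0# < x * y
  *-pos (0≤x , 0≉x) (0≤y , 0≉y) = *-nonNeg 0≤x 0≤y , *-nonzero (0≉x ∘ sym) (0≉y ∘ sym) ∘ sym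

  -- By totality only `z ≤ y` needs an argument; multiplying it by `x` turns the hypothesis into an
  -- equality, which can be cancelled.
  *-cancelˡ-≤ : ∀ {x y z} → 0# < x → x * y ≤ x * z → y ≤ z
  *-cancelˡ-≤ {x} {y} {z} (0≤x , 0≉x) xy≤xz with total y z
  ... | inj₁ y≤z = y≤z
  ... | inj₂ z≤y = ≤-reflexive (*-cancelˡ-≈ (0≉x ∘ sym) (≤-antisym xy≤xz (*-monoˡ-≤ 0≤x z≤y)))

  *-/-cancel : ∀ {x} y → 0# < x → x * (y / x) ≈ y
  *-/-cancel {x} y (_ , 0≉x) = trans (solve 3 (λ x y i → x :* (y :* i) := x :* i :* y) refl x y (x ⁻¹))
    (trans (*-congʳ (⁻¹-inverseʳ x (0≉x ∘ sym))) (*-identityˡ y))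

  y≤x*z⇒y/x≤z : ∀ {x y z} → 0# < x → y ≤ x * z → y / x ≤ z
  y≤x*z⇒y/x≤z {x} {y} 0<x y≤xz = *-cancelˡ-≤ 0<x (≤-respˡ-≈ (sym (*-/-cancel y 0<x)) y≤xz)

  /-nonNeg : ∀ {x y} → 0# ≤ y → 0# < x → 0# ≤ y / x
  /-nonNeg {x} {y} 0≤y 0<x = *-cancelˡ-≤ 0<x (begin
    x * 0#      ≈⟨ zeroʳ x ⟩
    0#          ≤⟨ 0≤y ⟩
    y           ≈⟨ *-/-cancel y 0<x ⟨
    x * (y / x) ∎)
    where open ≤-Reasoning

  /-pos : ∀ {x y} → 0# < y → 0# < x → 0# < y / x
  /-pos {x} {y} (0≤y , 0≉y) 0<x = /-nonNeg 0≤y 0<x , λ 0≈y/x →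
    0≉y (trans (sym (zeroʳ x)) (trans (*-congˡ 0≈y/x) (*-/-cancel y 0<x)))

  ι-nonNeg : ∀ n → 0# ≤ ι n
  ι-nonNeg zero    = ≤-refl
  ι-nonNeg (suc n) = ≤-respˡ-≈ (+-identityˡ 0#) (+-mono-≤ 0≤1 (ι-nonNeg n))

  ι-+ : ∀ m n → ι (m ℕ.+ n) ≈ ι m + ι n
  ι-+ zero    n = sym (+-identityˡ (ι n))
  ι-+ (suc m) n = trans (+-congˡ (ι-+ m n)) (sym (+-assoc 1# (ι m) (ι n)))

  ι-* : ∀ m n → ι (m ℕ.* n) ≈ ι m * ι n
  ι-* zero    n = sym (zeroˡ (ι n))
  ι-* (suc m) n = trans (ι-+ n (m ℕ.* n)) (trans (+-congˡ (ι-* m n))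
    (solve 2 (λ m n → n :+ m :* n := (con 1 :+ m) :* n) refl (ι m) (ι n)))

  ι-mono-≤ : ∀ {m n} → m ℕ.≤ n → ι m ≤ ι n
  ι-mono-≤ {n = n} z≤n = ι-nonNeg n
  ι-mono-≤ (s≤s m≤n)   = +-monoʳ-≤ 1# (ι-mono-≤ m≤n)

  -- Characteristic zero: 1 + n = 0 would give 1 ≤ 1 + n = 0 ≤ 1.
  ι-suc-pos : ∀ n → 0# < ι (suc n)
  ι-suc-pos n = ι-nonNeg (suc n) , λ 0≈ι → 0≉1 (≤-antisym 0≤1 (begin
    1#        ≈⟨ +-identityʳ 1# ⟨
    1# + 0#   ≤⟨ +-monoʳ-≤ 1# (ι-nonNeg n) ⟩
    1# + ι n  ≈⟨ 0≈ι ⟨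
    0#        ∎))
    where open ≤-Reasoning

  ι-pos : ∀ {n} → 1 ℕ.≤ n → 0# < ι n
  ι-pos (s≤s {n = n} _) = ι-suc-pos n

  -- Brings the estimate 2 |P| ≤ I back to ℕ, where the second-moment inequality lives.
  ι-cancel-≤ : ∀ {m n} → ι m ≤ ι n → m ℕ.≤ n
  ι-cancel-≤ {zero}          _     = z≤n
  ι-cancel-≤ {suc m} {zero}  ιm≤0  = contradiction (≤-antisym (ι-nonNeg (suc m)) ιm≤0) (proj₂ (ι-suc-pos m))
  ι-cancel-≤ {suc m} {suc n} ιm≤ιn = s≤s (ι-cancel-≤ (+-cancelˡ-≤ 1# ιm≤ιn))

  -- The split into large and small terms, used for pairs of spheres and again for spheres. Every
  -- entry is charged `t`, including those that satisfy `P`; this avoids counting the complement and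
  -- is where `0# ≤ t` enters.
  ∑≤t*length+M*count : ∀ {b p} {A : Set b} {P : Pred A p} (P? : Decidable P) (g : A → ℕ) M {t} → 0# ≤ t →
    (∀ x → P x → g x ℕ.≤ M) → (∀ x → ¬ P x → ι (g x) ≤ t) →
    ∀ xs → ι (∑ xs g) ≤ t * ι (length xs) + ι M * ι (count P? xs)
  ∑≤t*length+M*count P? g M {t} 0≤t g≤M g≤t []       =
    ≤-reflexive (solve 2 (λ t M → con 0 := t :* con 0 :+ M :* con 0) refl t (ι M))
  ∑≤t*length+M*count P? g M {t} 0≤t g≤M g≤t (x ∷ xs) with P? x
  ... | yes Px = begin
    ι (g x ℕ.+ ∑ xs g)               ≈⟨ ι-+ (g x) _ ⟩
    ι (g x) + ι (∑ xs g)             ≤⟨ +-mono-≤ (ι-mono-≤ (g≤M x Px)) (∑≤t*length+M*count P? g M 0≤t g≤M g≤t xs) ⟩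
    ι M + (t * n + ι M * k)          ≈⟨ solve 4 (λ M t n k → M :+ (t :* n :+ M :* k) := con 0 :+ (t :* n :+ M :* (con 1 :+ k))) refl (ι M) t n k ⟩
    0# + (t * n + ι M * (1# + k))    ≤⟨ +-mono-≤ 0≤t ≤-refl ⟩
    t + (t * n + ι M * (1# + k))     ≈⟨ solve 4 (λ M t n k → t :+ (t :* n :+ M :* (con 1 :+ k)) := t :* (con 1 :+ n) :+ M :* (con 1 :+ k)) refl (ι M) t n k ⟩
    t * (1# + n) + ι M * (1# + k)    ∎
    where
    open ≤-Reasoning
    n = ι (length xs)
    k = ι (count P? xs)
  ... | no ¬Px = begin
    ι (g x ℕ.+ ∑ xs g)               ≈⟨ ι-+ (g x) _ ⟩
    ι (g x) + ι (∑ xs g)             ≤⟨ +-mono-≤ (g≤t x ¬Px) (∑≤t*length+M*count P? g M 0≤t g≤M g≤t xs) ⟩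
    t + (t * n + ι M * k)            ≈⟨ solve 4 (λ M t n k → t :+ (t :* n :+ M :* k) := t :* (con 1 :+ n) :+ M :* k) refl (ι M) t n k ⟩
    t * (1# + n) + ι M * k           ∎
    where
    open ≤-Reasoning
    n = ι (length xs)
    k = ι (count P? xs)

  square≤square⇒≤ : ∀ {m n} → m ℕ.* m ℕ.≤ n ℕ.* n → m ℕ.≤ n
  square≤square⇒≤ m²≤n² = ℕ.≮⇒≥ λ n<m → ℕ.<⇒≱ (ℕ.*-mono-< n<m n<m) m²≤n²

  -- With n = `length xs` the total is at least 2tn. Entries below t account for at most tn, so the
  -- heavy ones account for at least tn; each weighs at most n, hence there are at least t of them.
  -- The same t bounds weight and number because `g` is bounded by the length of the list. The
  -- values k = 4 and k = 8 yield the denominators 8 and 16.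
  manyHeavy : ∀ {b} {A : Set b} (g : A → ℕ) xs → 1 ℕ.≤ length xs → (∀ x → g x ℕ.≤ length xs) →
              ∀ k {y} → 1 ℕ.≤ k → 0# ≤ y → y * ι (length xs) ≤ ι k * ι (∑ xs g) →
              let t = y / ι (2 ℕ.* k) in t ≤ ι (count (λ x → t ≤? ι (g x)) xs)
  manyHeavy g xs 1≤n g≤n k {y} 1≤k 0≤y yn≤kR = *-cancelˡ-≤ (ι-pos 1≤n) (+-cancelˡ-≤ (t * n) (begin
    t * n + n * t           ≤⟨ *-cancelˡ-≤ (ι-pos 1≤k) 2tn≤R ⟩
    ι (∑ xs g)              ≤⟨ ∑≤t*length+M*count heavy? g (length xs) (/-nonNeg 0≤y 0<2k) (λ x _ → g≤n x) light xs ⟩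
    t * n + n * ι (count heavy? xs) ∎))
    where
    open ≤-Reasoning
    n = ι (length xs)
    t = y / ι (2 ℕ.* k)
    heavy? = λ x → t ≤? ι (g x)

    0<2k : 0# < ι (2 ℕ.* k)
    0<2k = ι-pos (ℕ.≤-trans 1≤k (ℕ.m≤m+n k _))

    light : ∀ x → ¬ (t ≤ ι (g x)) → ι (g x) ≤ t
    light x t≰g with total t (ι (g x))
    ... | inj₁ t≤g = contradiction t≤g t≰g
    ... | inj₂ g≤t = g≤t

    2tn≤R : ι k * (t * n + n * t) ≤ ι k * ι (∑ xs g)
    2tn≤R = begin
      ι k * (t * n + n * t)     ≈⟨ solve 3 (λ k t n → k :* (t :* n :+ n :* t) := (con 2 :* k :* t) :* n) refl (ι k) t n ⟩
      -- The solver's numeral 2 is `1# + 1#`, whereas `ι 2` unfolds to `1# + (1# + 0#)`.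
      ((1# + 1#) * ι k * t) * n ≈⟨ *-congʳ (*-congʳ (*-congʳ (+-congˡ (+-identityʳ 1#)))) ⟨
      (ι 2 * ι k * t) * n       ≈⟨ *-congʳ (*-congʳ (ι-* 2 k)) ⟨
      (ι (2 ℕ.* k) * t) * n     ≈⟨ *-congʳ (*-/-cancel y 0<2k) ⟩
      y * n                     ≤⟨ yn≤kR ⟩
      ι k * ι (∑ xs g)          ∎

-- Finite fields of odd order and enumeration of their vectors.

module FiniteFieldProperties {c q} (𝔽 : FiniteField c q) where

  open FiniteField 𝔽
  open ≡
  open Inverse enumeration using (to; from; strictlyInverseˡ; strictlyInverseʳ)

  commutativeRing : CommutativeRing c c
  commutativeRing = record { isCommutativeRing = isCommutativeRing }

  open CommutativeRing commutativeRing public using (ring; commutativeSemiring)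
  open RingProperties ring public using (-1*x≈-x; x∙y⁻¹≈ε⇒x≈y; +-cancelʳ; +-cancelˡ; -‿involutive; -‿injective; -‿distribˡ-*)
  open SemiringSolver commutativeSemiring

  *-cancelˡ : ∀ {x y z} → x ≢ 0# → x * y ≡ x * z → y ≡ z
  *-cancelˡ {x} {y} {z} x≢0 xy≡xz = trans (cancel y) (trans (cong (x ⁻¹ *_) xy≡xz) (sym (cancel z)))
    where
    cancel : ∀ w → w ≡ x ⁻¹ * (x * w)
    cancel w = sym (trans (solve 3 (λ i x w → i :* (x :* w) := x :* i :* w) refl (x ⁻¹) x w)
                          (trans (cong (_* w) (⁻¹-inverseʳ x x≢0)) (*-identityˡ w)))

  x*y≡0⇒x≡0∨y≡0 : ∀ x y → x * y ≡ 0# → x ≡ 0# ⊎ y ≡ 0#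
  x*y≡0⇒x≡0∨y≡0 x y xy≡0 with x ≟ 0#
  ... | yes x≡0 = inj₁ x≡0
  ... | no  x≢0 = inj₂ (*-cancelˡ x≢0 (trans xy≡0 (sym (zeroʳ x))))

  elements : List Carrier
  elements = List.map from (allFin q)

  length-elements : length elements ≡ q
  length-elements = trans (length-map from (allFin q)) (length-tabulate id)

  elements-unique : Unique elements
  elements-unique = Unique.map⁺ (λ {i} {j} eq → trans (sym (strictlyInverseˡ i)) (trans (cong to eq) (strictlyInverseˡ j))) (Unique.allFin⁺ q)

  ∈-elements : ∀ x → x ∈ elements
  ∈-elements x = subst (_∈ elements) (strictlyInverseʳ x) (∈-map⁺ from (∈-allFin (to x)))

  2≤q : 2 ℕ.≤ q
  2≤q = subst (2 ℕ.≤_) length-elements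
    (injection⇒length≤ _≟_ id {xs = 0# ∷ 1# ∷ []} ((0≉1 ∷ []) ∷ [] ∷ []) (λ {x} _ → ∈-elements x) (λ _ _ eq → eq))

  -- If 2 = 0, then x ↦ x + 1 is an involution exchanging the x that precede x + 1 in the enumeration
  -- with those that follow it, so q is even.
  2≢0 : 2 ∤ q → 2# ≢ 0#
  2≢0 2∤q 2≡0 = 2∤q (divides (count <? elements) (begin
    q                                                     ≡⟨ length-elements ⟨
    length elements                                       ≡⟨ count+count¬ <? elements ⟨
    count <? elements ℕ.+ count (¬? ∘ <?) elements        ≡⟨ cong (count <? elements ℕ.+_) (ℕ.≤-antisym ≮≤< <≤≮) ⟩
    count <? elements ℕ.+ count <? elements               ≡⟨ cong (count <? elements ℕ.+_) (sym (ℕ.+-identityʳ _)) ⟩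
    2 ℕ.* count <? elements                               ≡⟨ ℕ.*-comm 2 (count <? elements) ⟩
    count <? elements ℕ.* 2                               ∎))
    where
    open ≡-Reasoning

    next : Carrier → Carrier
    next x = x + 1#

    next-next : ∀ x → next (next x) ≡ x
    next-next x = trans (+-assoc x 1# 1#) (trans (cong (x +_) 2≡0) (+-identityʳ x))

    next≢ : ∀ x → next x ≢ x
    next≢ x eq = 0≉1 (sym (+-cancelˡ x 1# 0# (trans eq (sym (+-identityʳ x)))))

    <? : Decidable (λ x → to x Fin.< to (next x))
    <? x = to x Fin.<? to (next x)

    next-injective : ∀ {x y} → next x ≡ next y → x ≡ y
    next-injective {x} {y} eq = trans (sym (next-next x)) (trans (cong next eq) (next-next y))

    to-injective : ∀ {x y} → to x ≡ to y → x ≡ y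
    to-injective {x} {y} eq = trans (sym (strictlyInverseʳ x)) (trans (cong from eq) (strictlyInverseʳ y))

    <≤≮ : count <? elements ℕ.≤ count (¬? ∘ <?) elements
    <≤≮ = injection⇒length≤ _≟_ next (Unique.filter⁺ <? elements-unique)
      (λ {x} x∈ → ∈-filter⁺ (¬? ∘ <?) (∈-elements (next x)) λ nx<nnx →
         Fin.<-asym {x = to x} (proj₂ (∈-filter⁻ <? {xs = elements} x∈)) (subst (λ y → to (next x) Fin.< to y) (next-next x) nx<nnx))
      (λ _ _ → next-injective)

    ≮≤< : count (¬? ∘ <?) elements ℕ.≤ count <? elements
    ≮≤< = injection⇒length≤ _≟_ next (Unique.filter⁺ (¬? ∘ <?) elements-unique)
      (λ {x} x∈ → ∈-filter⁺ <? (∈-elements (next x)) (subst (λ y → to (next x) Fin.< to y) (sym (next-next x))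
         -- Failure of `<` gives only a weak inequality; it is strict because `next` has no fixed
         -- point.
         (Fin.≤∧≢⇒< (ℕ.≮⇒≥ (proj₂ (∈-filter⁻ (¬? ∘ <?) {xs = elements} x∈))) (next≢ x ∘ to-injective))))
      (λ _ _ → next-injective)

  points : ∀ d → List (Vec Carrier d)
  points zero    = [] ∷ []
  points (suc d) = cartesianProductWith _∷_ elements (points d)

  length-points : ∀ d → length (points d) ≡ q ℕ.^ d
  length-points zero    = refl
  length-points (suc d) = trans (length-cartesianProductWith _∷_ elements (points d))
    (cong₂ ℕ._*_ length-elements (length-points d))

  points-unique : ∀ d → Unique (points d)
  points-unique zero    = [] ∷ []
  points-unique (suc d) = Unique.cartesianProductWith⁺ _∷_ ∷-injective elements-unique (points-unique d)

  ∈-points : ∀ {d} (x : Vec Carrier d) → x ∈ points d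
  ∈-points []      = here refl
  ∈-points (a ∷ x) = ∈-cartesianProductWith⁺ _∷_ (∈-elements a) (∈-points x)

-- Coordinatewise vector arithmetic.

module VectorProperties {c q} (𝔽 : FiniteField c q) {d : ℕ} (Q : Vec (FiniteField.Carrier 𝔽) d → FiniteField.Carrier 𝔽) where

  open FiniteField 𝔽
  open ≡
  open FiniteFieldProperties 𝔽
  open Geometry 𝔽 Q

  ⊕-comm : ∀ x y → x ⊕ y ≡ y ⊕ x
  ⊕-comm = zipWith-comm +-comm

  ⊕-assoc : ∀ x y z → (x ⊕ y) ⊕ z ≡ x ⊕ (y ⊕ z)
  ⊕-assoc = zipWith-assoc +-assoc

  ⊕-swap : ∀ x y z → (x ⊕ y) ⊕ z ≡ (x ⊕ z) ⊕ y
  ⊕-swap x y z = trans (⊕-assoc x y z) (trans (cong (x ⊕_) (⊕-comm y z)) (sym (⊕-assoc x z y)))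

  -- The length `d` is fixed by the module, so the induction is carried out in `go` over an
  -- arbitrary length; the same device recurs below.
  ⊕-identityˡ : ∀ x → 𝟎 ⊕ x ≡ x
  ⊕-identityˡ = go
    where
    go : ∀ {n} (x : Vec Carrier n) → Vec.zipWith _+_ (replicate n 0#) x ≡ x
    go []      = refl
    go (a ∷ x) = cong₂ _∷_ (+-identityˡ a) (go x)

  ⊖-⊕ : ∀ x y → (x ⊖ y) ⊕ y ≡ x
  ⊖-⊕ = go
    where
    go : ∀ {n} (x y : Vec Carrier n) → Vec.zipWith _+_ (Vec.zipWith _-_ x y) y ≡ x
    go []      []      = refl
    go (a ∷ x) (b ∷ y) = cong₂ _∷_ (trans (+-assoc a (- b) b) (trans (cong (a +_) (-‿inverseˡ b)) (+-identityʳ a))) (go x y)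

  ⊕-⊖ : ∀ x y → (x ⊕ y) ⊖ y ≡ x
  ⊕-⊖ = go
    where
    go : ∀ {n} (x y : Vec Carrier n) → Vec.zipWith _-_ (Vec.zipWith _+_ x y) y ≡ x
    go []      []      = refl
    go (a ∷ x) (b ∷ y) = cong₂ _∷_ (trans (+-assoc a b (- b)) (trans (cong (a +_) (-‿inverseʳ b)) (+-identityʳ a))) (go x y)

  ⊕-cancelʳ : ∀ x {y z} → y ⊕ x ≡ z ⊕ x → y ≡ z
  ⊕-cancelʳ x {y} {z} eq = trans (sym (⊕-⊖ y x)) (trans (cong (_⊖ x) eq) (⊕-⊖ z x))

  ⊖≡𝟎⇒≡ : ∀ {x y} → x ⊖ y ≡ 𝟎 → x ≡ y
  ⊖≡𝟎⇒≡ {x} {y} eq = trans (sym (⊖-⊕ x y)) (trans (cong (_⊕ y) eq) (⊕-identityˡ y))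

  ⊕-⊖-swap : ∀ x y z → (x ⊕ y) ⊖ z ≡ (x ⊖ z) ⊕ y
  ⊕-⊖-swap x y z = ⊕-cancelʳ z (trans (⊖-⊕ (x ⊕ y) z) (trans (cong (_⊕ y) (sym (⊖-⊕ x z))) (⊕-swap (x ⊖ z) z y)))

  ·-distribʳ-⊕ : ∀ a b x → (a + b) · x ≡ a · x ⊕ b · x
  ·-distribʳ-⊕ = go
    where
    go : ∀ {n} a b (x : Vec Carrier n) → Vec.map ((a + b) *_) x ≡ Vec.zipWith _+_ (Vec.map (a *_) x) (Vec.map (b *_) x)
    go a b []      = refl
    go a b (e ∷ x) = cong₂ _∷_ (distribʳ e a b) (go a b x)

  ⊖≡⊕-1· : ∀ x y → x ⊖ y ≡ x ⊕ (- 1#) · y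
  ⊖≡⊕-1· = go
    where
    go : ∀ {n} (x y : Vec Carrier n) → Vec.zipWith _-_ x y ≡ Vec.zipWith _+_ x (Vec.map ((- 1#) *_) y)
    go []      []      = refl
    go (a ∷ x) (b ∷ y) = cong₂ _∷_ (cong (a +_) (sym (-1*x≈-x b))) (go x y)

  line-difference : ∀ u {x y s t} → x ⊕ s · u ≡ y ⊕ t · u → y ≡ x ⊕ (s - t) · u
  line-difference u {x} {y} {s} {t} eq = ⊕-cancelʳ (t · u) (begin
    y ⊕ t · u                     ≡⟨ eq ⟨
    x ⊕ s · u                     ≡⟨ cong (λ a → x ⊕ a · u) s-t+t≡s ⟨
    x ⊕ ((s - t) + t) · u         ≡⟨ cong (x ⊕_) (·-distribʳ-⊕ (s - t) t u) ⟩
    x ⊕ ((s - t) · u ⊕ t · u)     ≡⟨ ⊕-assoc x _ _ ⟨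
    x ⊕ (s - t) · u ⊕ t · u       ∎)
    where
    open ≡-Reasoning
    s-t+t≡s : (s - t) + t ≡ s
    s-t+t≡s = trans (+-assoc s (- t) t) (trans (cong (s +_) (-‿inverseˡ t)) (+-identityʳ s))

  infix 4 _≟ᵥ_
  _≟ᵥ_ : ∀ (x y : Point) → Dec (x ≡ y)
  _≟ᵥ_ = Vec-≡-dec _≟_

-- Polar form, radical hyperplanes, and sections of spheres.

module QuadraticFormProperties {c q} (𝔽 : FiniteField c q) (2∤q : 2 ∤ q) {d : ℕ}
  (Q : Vec (FiniteField.Carrier 𝔽) d → FiniteField.Carrier 𝔽)
  (isQuadraticForm : Geometry.IsQuadraticForm 𝔽 Q) where

  open FiniteField 𝔽
  open ≡
  open FiniteFieldProperties 𝔽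
  open Geometry 𝔽 Q
  open IsQuadraticForm isQuadraticForm
  open VectorProperties 𝔽 Q
  open SemiringSolver commutativeSemiring
  open ≡-Reasoning

  2*⟨⟩ : ∀ x y → 2# * ⟨ x , y ⟩ ≡ (Q (x ⊕ y) - Q x) - Q y
  2*⟨⟩ x y = trans (solve 3 (λ t z i → t :* (z :* i) := t :* i :* z) refl 2# _ (2# ⁻¹))
    (trans (cong (_* _) (⁻¹-inverseʳ 2# (2≢0 2∤q))) (*-identityˡ _))

  Q-⊕ : ∀ x y → Q (x ⊕ y) ≡ (Q x + Q y) + 2# * ⟨ x , y ⟩
  Q-⊕ x y = sym (begin
    (Q x + Q y) + 2# * ⟨ x , y ⟩                        ≡⟨ cong ((Q x + Q y) +_) (2*⟨⟩ x y) ⟩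
    (Q x + Q y) + ((Q (x ⊕ y) - Q x) - Q y)
      ≡⟨ solve 5 (λ a b s a′ b′ → (a :+ b) :+ ((s :+ a′) :+ b′) := s :+ (a :+ a′) :+ (b :+ b′)) refl (Q x) (Q y) (Q (x ⊕ y)) (- Q x) (- Q y) ⟩
    Q (x ⊕ y) + (Q x - Q x) + (Q y - Q y)               ≡⟨ cong₂ (λ a b → Q (x ⊕ y) + a + b) (-‿inverseʳ (Q x)) (-‿inverseʳ (Q y)) ⟩
    Q (x ⊕ y) + 0# + 0#                                 ≡⟨ trans (+-identityʳ _) (+-identityʳ _) ⟩
    Q (x ⊕ y)                                           ∎)

  ⟨⟩-sym : ∀ x y → ⟨ x , y ⟩ ≡ ⟨ y , x ⟩
  ⟨⟩-sym x y = cong (_* 2# ⁻¹) (begin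
    (Q (x ⊕ y) - Q x) - Q y ≡⟨ cong (λ z → (Q z - Q x) - Q y) (⊕-comm x y) ⟩
    (Q (y ⊕ x) - Q x) - Q y ≡⟨ solve 3 (λ s a b → (s :+ a) :+ b := (s :+ b) :+ a) refl (Q (y ⊕ x)) (- Q x) (- Q y) ⟩
    (Q (y ⊕ x) - Q y) - Q x ∎)

  ⟨⟩-additiveʳ : ∀ x y z → ⟨ x , y ⊕ z ⟩ ≡ ⟨ x , y ⟩ + ⟨ x , z ⟩
  ⟨⟩-additiveʳ x y z = trans (⟨⟩-sym x (y ⊕ z)) (trans (⟨⟩-additive y z x) (cong₂ _+_ (⟨⟩-sym y x) (⟨⟩-sym z x)))

  ⟨⟩-scalarʳ : ∀ a x y → ⟨ x , a · y ⟩ ≡ a * ⟨ x , y ⟩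
  ⟨⟩-scalarʳ a x y = trans (⟨⟩-sym x (a · y)) (trans (⟨⟩-scalar a y x) (cong (a *_) (⟨⟩-sym y x)))

  ⟨⟩-lineʳ : ∀ x y a z → ⟨ x , y ⊕ a · z ⟩ ≡ ⟨ x , y ⟩ + a * ⟨ x , z ⟩
  ⟨⟩-lineʳ x y a z = trans (⟨⟩-additiveʳ x y (a · z)) (cong (⟨ x , y ⟩ +_) (⟨⟩-scalarʳ a x z))

  ⟨⟩-⊖ : ∀ x y z → ⟨ x ⊖ y , z ⟩ + ⟨ y , z ⟩ ≡ ⟨ x , z ⟩
  ⟨⟩-⊖ x y z = trans (sym (⟨⟩-additive (x ⊖ y) y z)) (cong (λ e → ⟨ e , z ⟩) (⊖-⊕ x y))

  -- The restriction of `Q` to a line is quadratic in the parameter. The factor `a` is pulled out so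
  -- that equal values of `Q` at two points become a vanishing product.
  Q-line : ∀ x a y → Q (x ⊕ a · y) ≡ Q x + a * (a * Q y + 2# * ⟨ x , y ⟩)
  Q-line x a y = begin
    Q (x ⊕ a · y)                                       ≡⟨ Q-⊕ x (a · y) ⟩
    (Q x + Q (a · y)) + 2# * ⟨ x , a · y ⟩              ≡⟨ cong₂ (λ e f → (Q x + e) + 2# * f) (homogeneous a y) (⟨⟩-scalarʳ a x y) ⟩
    (Q x + a * a * Q y) + 2# * (a * ⟨ x , y ⟩)
      ≡⟨ solve 5 (λ X a Y t B → (X :+ a :* a :* Y) :+ t :* (a :* B) := X :+ a :* (a :* Y :+ t :* B)) refl (Q x) a (Q y) 2# ⟨ x , y ⟩ ⟩
    Q x + a * (a * Q y + 2# * ⟨ x , y ⟩)                ∎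

  -- The point of the line through x in direction y with parameter -1. The cross term stays on the
  -- left to keep subtraction out: the solver is one for semirings and treats negatives as atoms.
  Q-⊖ : ∀ x y → Q (x ⊖ y) + 2# * ⟨ x , y ⟩ ≡ Q x + Q y
  Q-⊖ x y = begin
    Q (x ⊖ y) + 2# * B                                  ≡⟨ cong (λ z → Q z + 2# * B) (⊖≡⊕-1· x y) ⟩
    Q (x ⊕ (- 1#) · y) + 2# * B                         ≡⟨ cong (_+ 2# * B) (Q-line x (- 1#) y) ⟩
    Q x + (- 1#) * ((- 1#) * Q y + 2# * B) + 2# * B
      ≡⟨ solve 4 (λ X m Y b → X :+ m :* (m :* Y :+ b) :+ b := (X :+ (m :* m) :* Y) :+ (con 1 :+ m) :* b) refl (Q x) (- 1#) (Q y) (2# * B) ⟩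
    (Q x + ((- 1#) * (- 1#)) * Q y) + (1# - 1#) * (2# * B)
      ≡⟨ cong₂ (λ e f → (Q x + e * Q y) + f * (2# * B)) -1*-1≡1 (-‿inverseʳ 1#) ⟩
    (Q x + 1# * Q y) + 0# * (2# * B)                    ≡⟨ solve 3 (λ X Y b → (X :+ con 1 :* Y) :+ con 0 :* b := X :+ Y) refl (Q x) (Q y) (2# * B) ⟩
    Q x + Q y                                           ∎
    where
    B = ⟨ x , y ⟩
    -1*-1≡1 : (- 1#) * (- 1#) ≡ 1#
    -1*-1≡1 = trans (-1*x≈-x (- 1#)) (-‿involutive 1#)

  -- When both sphere equations are expanded, `Q x` occurs in each and cancels; what remains is
  -- linear in x.
  ∈ₛ∩⇒∈H : ∀ {x} S S′ → x ∈ₛ S → x ∈ₛ S′ → x ∈H⟨ S , S′ ⟩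
  ∈ₛ∩⇒∈H {x} (c₁ , r₁) (c₂ , r₂) x∈S x∈S′ = begin
    B                                                   ≡⟨ solve 1 (λ B → B := B :+ con 0 :+ con 0) refl B ⟩
    B + 0# + 0#                                         ≡⟨ cong₂ (λ e f → B + e + f) (-‿inverseʳ r₂) (-‿inverseʳ (Q c₁)) ⟨
    B + (r₂ - r₂) + (Q c₁ - Q c₁)
      ≡⟨ solve 5 (λ B r n q m → B :+ (r :+ n) :+ (q :+ m) := (B :+ r :+ q) :+ (n :+ m)) refl B r₂ (- r₂) (Q c₁) (- Q c₁) ⟩
    (B + r₂ + Q c₁) + (- r₂ + - Q c₁)                   ≡⟨ cong (_+ (- r₂ + - Q c₁)) B+r₂+Qc₁ ⟩
    (r₁ + Q c₂) + (- r₂ + - Q c₁)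
      ≡⟨ solve 4 (λ r q n m → (r :+ q) :+ (n :+ m) := ((r :+ n) :+ m) :+ q) refl r₁ (Q c₂) (- r₂) (- Q c₁) ⟩
    ((r₁ - r₂) - Q c₁) + Q c₂                           ∎
    where
    B  = 2# * ⟨ c₂ ⊖ c₁ , x ⟩

    sphere : ∀ c r → Q (x ⊖ c) ≡ r → r + 2# * ⟨ c , x ⟩ ≡ Q x + Q c
    sphere c r x∈ = trans (cong₂ (λ e f → e + 2# * f) (sym x∈) (⟨⟩-sym c x)) (Q-⊖ x c)

    B+r₂+Qc₁ : B + r₂ + Q c₁ ≡ r₁ + Q c₂
    B+r₂+Qc₁ = +-cancelʳ (2# * ⟨ c₁ , x ⟩) _ _ (begin
      B + r₂ + Q c₁ + 2# * ⟨ c₁ , x ⟩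
        ≡⟨ solve 5 (λ t d r q b → t :* d :+ r :+ q :+ t :* b := (r :+ t :* (d :+ b)) :+ q) refl 2# ⟨ c₂ ⊖ c₁ , x ⟩ r₂ (Q c₁) ⟨ c₁ , x ⟩ ⟩
      (r₂ + 2# * (⟨ c₂ ⊖ c₁ , x ⟩ + ⟨ c₁ , x ⟩)) + Q c₁ ≡⟨ cong (λ e → (r₂ + 2# * e) + Q c₁) (⟨⟩-⊖ c₂ c₁ x) ⟩
      (r₂ + 2# * ⟨ c₂ , x ⟩) + Q c₁                     ≡⟨ cong (_+ Q c₁) (sphere c₂ r₂ x∈S′) ⟩
      (Q x + Q c₂) + Q c₁                               ≡⟨ solve 3 (λ x y z → (x :+ y) :+ z := (x :+ z) :+ y) refl (Q x) (Q c₂) (Q c₁) ⟩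
      (Q x + Q c₁) + Q c₂                               ≡⟨ cong (_+ Q c₂) (sphere c₁ r₁ x∈S) ⟨
      (r₁ + 2# * ⟨ c₁ , x ⟩) + Q c₂                     ≡⟨ solve 3 (λ x y z → (x :+ y) :+ z := (x :+ z) :+ y) refl r₁ _ (Q c₂) ⟩
      r₁ + Q c₂ + 2# * ⟨ c₁ , x ⟩                       ∎)

  private
    elements² : List (Carrier × Carrier)
    elements² = cartesianProduct elements elements

    length-elements² : length elements² ≡ q ℕ.* q
    length-elements² = trans (length-cartesianProductWith _,_ elements elements) (cong₂ ℕ._*_ length-elements length-elements)

  -- (x , t) ↦ x + t w is injective on xs × 𝔽.
  hyperplane-bound : ∀ {v w b xs} → ⟨ v , w ⟩ ≢ 0# → Unique xs → (∀ {x} → x ∈ xs → ⟨ v , x ⟩ ≡ b) →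
                     length xs ℕ.* q ℕ.≤ q ℕ.^ d
  hyperplane-bound {v} {w} {b} {xs} ⟨v,w⟩≢0 xs! xs⊆H =
    subst₂ ℕ._≤_ (trans (length-cartesianProductWith _,_ xs elements) (cong (length xs ℕ.*_) length-elements)) (length-points d)
      (injection⇒length≤ _≟ᵥ_ shift (Unique.cartesianProduct⁺ xs! elements-unique) (λ _ → ∈-points _) injective)
    where
    shift : Point × Carrier → Point
    shift (x , t) = x ⊕ t · w

    ⟨v,shift⟩ : ∀ {p} → p ∈ cartesianProduct xs elements → ⟨ v , shift p ⟩ ≡ b + proj₂ p * ⟨ v , w ⟩
    ⟨v,shift⟩ {x , t} p∈ = trans (⟨⟩-lineʳ v x t w) (cong (_+ t * ⟨ v , w ⟩) (xs⊆H (proj₁ (∈-cartesianProduct⁻ xs elements p∈))))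

    injective : ∀ {p p′} → p ∈ cartesianProduct xs elements → p′ ∈ cartesianProduct xs elements → shift p ≡ shift p′ → p ≡ p′
    injective {x , t} {x′ , t′} p∈ p′∈ eq = cong₂ _,_ x≡x′ t≡t′
      where
      t≡t′ : t ≡ t′
      t≡t′ = *-cancelˡ ⟨v,w⟩≢0 (trans (*-comm _ t) (trans
        (+-cancelˡ b _ _ (trans (sym (⟨v,shift⟩ p∈)) (trans (cong (λ z → ⟨ v , z ⟩) eq) (⟨v,shift⟩ p′∈)))) (*-comm t′ _)))
      x≡x′ : x ≡ x′
      x≡x′ = ⊕-cancelʳ (t · w) (trans eq (cong (λ s → x′ ⊕ s · w) (sym t≡t′)))

  -- Since y = x + (t - s) u, comparing `Q` at x - c and y - c leaves a product equal to zero. Its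
  -- second factor is linear in s with leading coefficient -Q(u), so it pins down s once Q(u) ≠ 0.
  sphere∩line-root : ∀ {u c r x t y s} → Q (x ⊖ c) ≡ r → Q (y ⊖ c) ≡ r → x ⊕ t · u ≡ y ⊕ s · u →
                     t ≡ s ⊎ (t - s) * Q u + 2# * ⟨ x ⊖ c , u ⟩ ≡ 0#
  sphere∩line-root {u} {c} {r} {x} {t} {y} {s} x∈ y∈ eq = factor (x*y≡0⇒x≡0∨y≡0 τ e τe≡0)
    where
    τ = t - s
    e = τ * Q u + 2# * ⟨ x ⊖ c , u ⟩

    τe≡0 : τ * e ≡ 0#
    τe≡0 = +-cancelˡ r (τ * e) 0# (begin
      r + τ * e                     ≡⟨ cong (_+ τ * e) x∈ ⟨
      Q (x ⊖ c) + τ * e             ≡⟨ Q-line (x ⊖ c) τ u ⟨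
      Q ((x ⊖ c) ⊕ τ · u)           ≡⟨ cong Q (⊕-⊖-swap x (τ · u) c) ⟨
      Q ((x ⊕ τ · u) ⊖ c)           ≡⟨ cong (λ z → Q (z ⊖ c)) (line-difference u eq) ⟨
      Q (y ⊖ c)                     ≡⟨ y∈ ⟩
      r                             ≡⟨ +-identityʳ r ⟨
      r + 0#                        ∎)

    factor : τ ≡ 0# ⊎ e ≡ 0# → t ≡ s ⊎ e ≡ 0#
    factor (inj₁ τ≡0) = inj₁ (x∙y⁻¹≈ε⇒x≈y t s τ≡0)
    factor (inj₂ e≡0) = inj₂ e≡0

  -- A line in an anisotropic direction meets a sphere at most twice. Points are indexed by the
  -- multiple of u that carries them to one common point, which is how they arise in a fibre of
  -- `shift`.
  sphere∩line : ∀ {u c r x t y₁ t₁ y₂ t₂} → Q u ≢ 0# →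
                Q (x ⊖ c) ≡ r → Q (y₁ ⊖ c) ≡ r → Q (y₂ ⊖ c) ≡ r →
                x ⊕ t · u ≡ y₁ ⊕ t₁ · u → x ⊕ t · u ≡ y₂ ⊕ t₂ · u → t ≡ t₁ ⊎ t ≡ t₂ ⊎ t₁ ≡ t₂
  sphere∩line {u} {c} {r} {x} {t} {y₁} {t₁} {y₂} {t₂} Qu≢0 x∈ y₁∈ y₂∈ eq₁ eq₂ =
    combine (sphere∩line-root x∈ y₁∈ eq₁) (sphere∩line-root x∈ y₂∈ eq₂)
    where
    b = 2# * ⟨ x ⊖ c , u ⟩

    combine : t ≡ t₁ ⊎ (t - t₁) * Q u + b ≡ 0# → t ≡ t₂ ⊎ (t - t₂) * Q u + b ≡ 0# → t ≡ t₁ ⊎ t ≡ t₂ ⊎ t₁ ≡ t₂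
    combine (inj₁ t≡t₁) _           = inj₁ t≡t₁
    combine (inj₂ _)    (inj₁ t≡t₂) = inj₂ (inj₁ t≡t₂)
    combine (inj₂ root₁) (inj₂ root₂) = inj₂ (inj₂ (-‿injective (+-cancelˡ t (- t₁) (- t₂) (*-cancelˡ Qu≢0 (begin
      Q u * (t - t₁)  ≡⟨ *-comm (Q u) (t - t₁) ⟩
      (t - t₁) * Q u  ≡⟨ +-cancelʳ b ((t - t₁) * Q u) ((t - t₂) * Q u) (trans root₁ (sym root₂)) ⟩
      (t - t₂) * Q u  ≡⟨ *-comm (Q u) (t - t₂) ⟨
      Q u * (t - t₂)  ∎)))))

  -- (x , s , t) ↦ x + s w + t u is at most two-to-one on xs × 𝔽 × 𝔽:  ⟨v,·⟩ recovers s, and then t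
  -- is a root of a polynomial with leading coefficient Q(u).
  hyperplane∩sphere-bound : ∀ {v w u b c r xs} → ⟨ v , w ⟩ ≢ 0# → ⟨ v , u ⟩ ≡ 0# → Q u ≢ 0# → Unique xs →
                            (∀ {x} → x ∈ xs → ⟨ v , x ⟩ ≡ b) → (∀ {x} → x ∈ xs → Q (x ⊖ c) ≡ r) →
                            length xs ℕ.* (q ℕ.* q) ℕ.≤ 2 ℕ.* q ℕ.^ d
  hyperplane∩sphere-bound {v} {w} {u} {b} {c} {r} {xs} ⟨v,w⟩≢0 ⟨v,u⟩≡0 Qu≢0 xs! xs⊆H xs⊆S =
    subst₂ (λ m n → m ℕ.≤ 2 ℕ.* n)
      (trans (length-cartesianProductWith _,_ xs elements²) (cong (length xs ℕ.*_) length-elements²)) (length-points d)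
      (length≤fibre*length _≟ᵥ_ shift 2 {xs = triples} (λ _ → ∈-points _) fibre≤2)
    where
    triples : List (Point × Carrier × Carrier)
    triples = cartesianProduct xs elements²

    triples! : Unique triples
    triples! = Unique.cartesianProduct⁺ xs! (Unique.cartesianProduct⁺ elements-unique elements-unique)

    shift : Point × Carrier × Carrier → Point
    shift (x , s , t) = (x ⊕ s · w) ⊕ t · u

    ⟨v,shift⟩ : ∀ {x s t} → x ∈ xs → ⟨ v , shift (x , s , t) ⟩ ≡ b + s * ⟨ v , w ⟩
    ⟨v,shift⟩ {x} {s} {t} x∈ = begin
      ⟨ v , (x ⊕ s · w) ⊕ t · u ⟩                         ≡⟨ ⟨⟩-lineʳ v _ t u ⟩
      ⟨ v , x ⊕ s · w ⟩ + t * ⟨ v , u ⟩                   ≡⟨ cong₂ (λ e f → e + t * f) (⟨⟩-lineʳ v x s w) ⟨v,u⟩≡0 ⟩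
      (⟨ v , x ⟩ + s * ⟨ v , w ⟩) + t * 0#                ≡⟨ trans (cong ((⟨ v , x ⟩ + s * ⟨ v , w ⟩) +_) (zeroʳ t)) (+-identityʳ _) ⟩
      ⟨ v , x ⟩ + s * ⟨ v , w ⟩                           ≡⟨ cong (_+ s * ⟨ v , w ⟩) (xs⊆H x∈) ⟩
      b + s * ⟨ v , w ⟩                                   ∎

    shift-s : ∀ {x s t x′ s′ t′} → x ∈ xs → x′ ∈ xs → shift (x , s , t) ≡ shift (x′ , s′ , t′) → s ≡ s′
    shift-s {s = s} {s′ = s′} x∈ x′∈ eq = *-cancelˡ ⟨v,w⟩≢0 (trans (*-comm _ s) (trans
      (+-cancelˡ b _ _ (trans (sym (⟨v,shift⟩ x∈)) (trans (cong (λ z → ⟨ v , z ⟩) eq) (⟨v,shift⟩ x′∈)))) (*-comm s′ _)))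

    shift-line : ∀ {x s t x′ t′} → shift (x , s , t) ≡ shift (x′ , s , t′) → x ⊕ t · u ≡ x′ ⊕ t′ · u
    shift-line {x} {s} {t} {x′} {t′} eq = ⊕-cancelʳ (s · w) (trans (⊕-swap x (t · u) (s · w)) (trans eq (⊕-swap x′ (s · w) (t′ · u))))

    line-injective : ∀ {x s t x′ t′} → x ⊕ t · u ≡ x′ ⊕ t′ · u → t ≡ t′ → (x , s , t) ≡ (x′ , s , t′)
    line-injective {s = s} {t} eq refl = cong (_, s , t) (⊕-cancelʳ (t · u) eq)

    two-of-three : ∀ {p p₁ p₂} → proj₁ p ∈ xs → proj₁ p₁ ∈ xs → proj₁ p₂ ∈ xs →
                   shift p ≡ shift p₁ → shift p ≡ shift p₂ → p ≡ p₁ ⊎ p ≡ p₂ ⊎ p₁ ≡ p₂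
    two-of-three {x , s , t} {x₁ , s₁ , t₁} {x₂ , s₂ , t₂} x∈ x₁∈ x₂∈ eq₁ eq₂ =
      combine (shift-s {t = t} {t′ = t₁} x∈ x₁∈ eq₁) (shift-s {t = t} {t′ = t₂} x∈ x₂∈ eq₂)
      where
      combine : s ≡ s₁ → s ≡ s₂ → (x , s , t) ≡ (x₁ , s₁ , t₁) ⊎ (x , s , t) ≡ (x₂ , s₂ , t₂) ⊎ (x₁ , s₁ , t₁) ≡ (x₂ , s₂ , t₂)
      -- With the s-components identified, the three points lie on one line in direction u.
      combine refl refl = conclude (sphere∩line {u} {c} {r} {x} {t} {x₁} {t₁} {x₂} {t₂} Qu≢0 (xs⊆S x∈) (xs⊆S x₁∈) (xs⊆S x₂∈) line₁ line₂)
        where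
        line₁ : x ⊕ t · u ≡ x₁ ⊕ t₁ · u
        line₁ = shift-line {x} {s} {t} {x₁} {t₁} eq₁
        line₂ : x ⊕ t · u ≡ x₂ ⊕ t₂ · u
        line₂ = shift-line {x} {s} {t} {x₂} {t₂} eq₂

        conclude : t ≡ t₁ ⊎ t ≡ t₂ ⊎ t₁ ≡ t₂ → (x , s , t) ≡ (x₁ , s , t₁) ⊎ (x , s , t) ≡ (x₂ , s , t₂) ⊎ (x₁ , s , t₁) ≡ (x₂ , s , t₂)
        conclude (inj₁ t≡t₁)         = inj₁ (line-injective {x} {s} {t} {x₁} {t₁} line₁ t≡t₁)
        conclude (inj₂ (inj₁ t≡t₂))  = inj₂ (inj₁ (line-injective {x} {s} {t} {x₂} {t₂} line₂ t≡t₂))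
        conclude (inj₂ (inj₂ t₁≡t₂)) = inj₂ (inj₂ (line-injective {x₁} {s} {t₁} {x₂} {t₂} (trans (sym line₁) line₂) t₁≡t₂))

    fibre≤2 : ∀ y → count (λ p → shift p ≟ᵥ y) triples ℕ.≤ 2
    fibre≤2 y = unique-length≤2 (Unique.filter⁺ (λ p → shift p ≟ᵥ y) triples!) λ p∈ p₁∈ p₂∈ →
      let p∈′  , eq  = ∈-filter⁻ (λ p → shift p ≟ᵥ y) {xs = triples} p∈
          p₁∈′ , eq₁ = ∈-filter⁻ (λ p → shift p ≟ᵥ y) {xs = triples} p₁∈
          p₂∈′ , eq₂ = ∈-filter⁻ (λ p → shift p ≟ᵥ y) {xs = triples} p₂∈
      in two-of-three (proj₁ (∈-cartesianProduct⁻ xs elements² p∈′)) (proj₁ (∈-cartesianProduct⁻ xs elements² p₁∈′))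
           (proj₁ (∈-cartesianProduct⁻ xs elements² p₂∈′)) (trans eq (sym eq₁)) (trans eq (sym eq₂))

  module _ (nondegenerate : Nondegenerate) where

    -- Searching the finite list of all vectors turns the failure of "v is orthogonal to everything"
    -- into an explicit witness.
    nonorthogonal : ∀ {v} → v ≢ 𝟎 → ∃ λ w → ⟨ v , w ⟩ ≢ 0#
    nonorthogonal {v} v≢𝟎 with any? (λ w → ¬? (⟨ v , w ⟩ ≟ 0#)) (points d)
    ... | yes found = let w , _ , ⟨v,w⟩≢0 = find found in w , ⟨v,w⟩≢0
    ... | no  none  = contradiction (nondegenerate v λ w → decidable-stable (⟨ v , w ⟩ ≟ 0#) (none ∘ lose (∈-points w))) v≢𝟎

    -- If Q vanishes on v^⊥, then a vector orthogonal to v and w is orthogonal to v^⊥ and to w, hence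
    -- zero; so x ↦ (⟨v,x⟩ , ⟨w,x⟩) is injective.
    anisotropic-in-hyperplane : 3 ℕ.≤ d → ∀ {v w} → ⟨ v , w ⟩ ≢ 0# → ∃ λ u → ⟨ v , u ⟩ ≡ 0# × Q u ≢ 0#
    anisotropic-in-hyperplane 3≤d {v} {w} ⟨v,w⟩≢0
      with any? (λ u → (⟨ v , u ⟩ ≟ 0#) ×-dec ¬? (Q u ≟ 0#)) (points d)
    ... | yes found = let u , _ , ⟨v,u⟩≡0 , Qu≢0 = find found in u , ⟨v,u⟩≡0 , Qu≢0
    -- An injection of 𝔽^d into 𝔽² is impossible because q² < q³ ≤ q^d.
    ... | no  none  = contradiction q^d≤q² (ℕ.<⇒≱ (ℕ.<-≤-trans (ℕ.^-monoʳ-< q 2≤q {2} {3} ℕ.≤-refl) (ℕ.^-monoʳ-≤ q {{ℕ.>-nonZero (ℕ.<⇒≤ 2≤q)}} 3≤d)))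
      where
      isotropic : ∀ x → ⟨ v , x ⟩ ≡ 0# → Q x ≡ 0#
      isotropic x ⟨v,x⟩≡0 = decidable-stable (Q x ≟ 0#) λ Qx≢0 → none (lose (∈-points x) (⟨v,x⟩≡0 , Qx≢0))

      orthogonal : ∀ x y → ⟨ v , x ⟩ ≡ 0# → ⟨ v , y ⟩ ≡ 0# → ⟨ x , y ⟩ ≡ 0#
      orthogonal x y x⊥v y⊥v = *-cancelˡ (2≢0 2∤q) (begin
        2# * ⟨ x , y ⟩                      ≡⟨ solve 1 (λ b → b := (con 0 :+ con 0) :+ b) refl _ ⟩
        (0# + 0#) + 2# * ⟨ x , y ⟩          ≡⟨ cong₂ (λ e f → (e + f) + 2# * ⟨ x , y ⟩) (isotropic x x⊥v) (isotropic y y⊥v) ⟨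
        (Q x + Q y) + 2# * ⟨ x , y ⟩        ≡⟨ Q-⊕ x y ⟨
        Q (x ⊕ y)                           ≡⟨ isotropic (x ⊕ y) (trans (⟨⟩-additiveʳ v x y) (trans (cong₂ _+_ x⊥v y⊥v) (+-identityˡ 0#))) ⟩
        0#                                  ≡⟨ zeroʳ 2# ⟨
        2# * 0#                             ∎)

      trivial : ∀ z → ⟨ v , z ⟩ ≡ 0# → ⟨ w , z ⟩ ≡ 0# → z ≡ 𝟎
      trivial z z⊥v z⊥w = nondegenerate z λ x →
        -- `a` is chosen to move x along w into v^⊥. As z is orthogonal to w, the pairing with z is
        -- unchanged by this move.
        let a  = - (⟨ v , x ⟩ * ⟨ v , w ⟩ ⁻¹)
            ⟨v,x+aw⟩≡0 : ⟨ v , x ⊕ a · w ⟩ ≡ 0#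
            ⟨v,x+aw⟩≡0 = begin
              ⟨ v , x ⊕ a · w ⟩                                          ≡⟨ ⟨⟩-lineʳ v x a w ⟩
              ⟨ v , x ⟩ + a * ⟨ v , w ⟩                                  ≡⟨ cong (⟨ v , x ⟩ +_) (-‿distribˡ-* _ ⟨ v , w ⟩) ⟨
              ⟨ v , x ⟩ - ⟨ v , x ⟩ * ⟨ v , w ⟩ ⁻¹ * ⟨ v , w ⟩
                ≡⟨ cong (λ e → ⟨ v , x ⟩ - e) (solve 3 (λ a i b → a :* i :* b := a :* (b :* i)) refl ⟨ v , x ⟩ (⟨ v , w ⟩ ⁻¹) ⟨ v , w ⟩) ⟩
              ⟨ v , x ⟩ - ⟨ v , x ⟩ * (⟨ v , w ⟩ * ⟨ v , w ⟩ ⁻¹)         ≡⟨ cong (λ e → ⟨ v , x ⟩ - ⟨ v , x ⟩ * e) (⁻¹-inverseʳ _ ⟨v,w⟩≢0) ⟩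
              ⟨ v , x ⟩ - ⟨ v , x ⟩ * 1#                                 ≡⟨ cong (λ e → ⟨ v , x ⟩ - e) (*-identityʳ _) ⟩
              ⟨ v , x ⟩ - ⟨ v , x ⟩                                      ≡⟨ -‿inverseʳ _ ⟩
              0#                                                         ∎
        in begin
          ⟨ z , x ⟩                         ≡⟨ +-identityʳ _ ⟨
          ⟨ z , x ⟩ + 0#                    ≡⟨ cong (⟨ z , x ⟩ +_) (trans (cong (a *_) (trans (⟨⟩-sym z w) z⊥w)) (zeroʳ a)) ⟨
          ⟨ z , x ⟩ + a * ⟨ z , w ⟩         ≡⟨ ⟨⟩-lineʳ z x a w ⟨
          ⟨ z , x ⊕ a · w ⟩                 ≡⟨ orthogonal z (x ⊕ a · w) z⊥v ⟨v,x+aw⟩≡0 ⟩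
          0#                                ∎

      ⟨⟩-difference : ∀ e x y → ⟨ e , x ⟩ ≡ ⟨ e , y ⟩ → ⟨ e , x ⊖ y ⟩ ≡ 0#
      ⟨⟩-difference e x y eq = +-cancelʳ ⟨ e , y ⟩ _ _ (begin
        ⟨ e , x ⊖ y ⟩ + ⟨ e , y ⟩           ≡⟨ ⟨⟩-additiveʳ e (x ⊖ y) y ⟨
        ⟨ e , (x ⊖ y) ⊕ y ⟩                 ≡⟨ cong (λ z → ⟨ e , z ⟩) (⊖-⊕ x y) ⟩
        ⟨ e , x ⟩                           ≡⟨ eq ⟩
        ⟨ e , y ⟩                           ≡⟨ +-identityˡ _ ⟨
        0# + ⟨ e , y ⟩                      ∎)

      q^d≤q² : q ℕ.^ d ℕ.≤ q ℕ.^ 2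
      q^d≤q² = subst₂ ℕ._≤_ (length-points d) (trans length-elements² (cong (q ℕ.*_) (sym (ℕ.*-identityʳ q))))
        (injection⇒length≤ (×-≡-dec _≟_ _≟_) (λ x → ⟨ v , x ⟩ , ⟨ w , x ⟩) (points-unique d)
          (λ _ → ∈-cartesianProduct⁺ (∈-elements _) (∈-elements _))
          (λ {x} {y} _ _ eq → let ev , ew = ,-injective eq in
            ⊖≡𝟎⇒≡ (trivial (x ⊖ y) (⟨⟩-difference v x y ev) (⟨⟩-difference w x y ew))))

nonempty⇒1≤length : ∀ {a} {A : Set a} {xs : List A} → xs ≢ [] → 1 ℕ.≤ length xs
nonempty⇒1≤length {xs = []}    xs≢[] = contradiction ≡.refl xs≢[]
nonempty⇒1≤length {xs = _ ∷ _} _     = s≤s z≤n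

-- Upper bounds for the intersection of two spheres.

module IntersectionBounds {c q} (𝔽 : FiniteField c q) (2∤q : 2 ∤ q) {d : ℕ}
  (Q : Vec (FiniteField.Carrier 𝔽) d → FiniteField.Carrier 𝔽)
  (isQuadraticForm : Geometry.IsQuadraticForm 𝔽 Q) (nondegenerate : Geometry.Nondegenerate 𝔽 Q) where

  open FiniteField 𝔽
  open FiniteFieldProperties 𝔽
  open Geometry 𝔽 Q
  open VectorProperties 𝔽 Q
  open QuadraticFormProperties 𝔽 2∤q Q isQuadraticForm

  private
    1≤q : 1 ℕ.≤ q
    1≤q = ℕ.<⇒≤ 2≤q

  module _ {P : List Point} (P! : Unique P) (S S′ : Sphere) where

    private
      ∈both? : ∀ x → Dec (x ∈ₛ S × x ∈ₛ S′)
      ∈both? x = (x ∈ₛ? S) ×-dec (x ∈ₛ? S′)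

      common : List Point
      common = filter ∈both? P

      common! : Unique common
      common! = Unique.filter⁺ ∈both? P!

      ∈common⁻ : ∀ {x} → x ∈ common → x ∈ₛ S × x ∈ₛ S′
      ∈common⁻ x∈ = proj₂ (∈-filter⁻ ∈both? {xs = P} x∈)

      v : Point
      v = center S′ ⊖ center S

      -- The equation of the radical hyperplane divided by 2, in the form ⟨v,x⟩ = b that the
      -- counting bounds expect.
      level : Carrier
      level = 2# ⁻¹ * (((radius S - radius S′) - Q (center S)) + Q (center S′))

      ⟨v,common⟩ : ∀ {x} → x ∈ common → ⟨ v , x ⟩ ≡ level
      ⟨v,common⟩ {x} x∈ = *-cancelˡ (2≢0 2∤q) (begin
        2# * ⟨ v , x ⟩                  ≡⟨ ∈ₛ∩⇒∈H S S′ (proj₁ (∈common⁻ x∈)) (proj₂ (∈common⁻ x∈)) ⟩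
        rhs                             ≡⟨ *-identityˡ rhs ⟨
        1# * rhs                        ≡⟨ ≡.cong (_* rhs) (⁻¹-inverseʳ 2# (2≢0 2∤q)) ⟨
        2# * 2# ⁻¹ * rhs                ≡⟨ *-assoc 2# (2# ⁻¹) rhs ⟩
        2# * level                      ∎)
        where
        open ≡.≡-Reasoning
        rhs = ((radius S - radius S′) - Q (center S)) + Q (center S′)

    concentric-disjoint : S ≢ S′ → center S ≡ center S′ → ∣ P ∩ S ∩ S′ ∣ ≡ 0
    concentric-disjoint S≢S′ c≡c′ = ≡.cong length (filter-none ∈both? (All.universal disjoint P))
      where
      disjoint : ∀ x → ¬ (x ∈ₛ S × x ∈ₛ S′)
      disjoint x (x∈S , x∈S′) =
        S≢S′ (≡.cong₂ _,_ c≡c′ (≡.trans (≡.sym x∈S) (≡.trans (≡.cong (λ c → Q (x ⊖ c)) c≡c′) x∈S′)))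

    common≤hyperplane : ∣ P ∩ S ∩ S′ ∣ ℕ.≤ ∣ P ∩H⟨ S , S′ ⟩∣
    common≤hyperplane = count-⊆ ∈both? (∈H? S S′) P λ {x} (x∈S , x∈S′) → ∈ₛ∩⇒∈H {x} S S′ x∈S x∈S′

    module _ (c≢c′ : center S ≢ center S′) where

      private
        w,⟨v,w⟩≢0 = nonorthogonal nondegenerate {v} (c≢c′ ∘ ≡.sym ∘ ⊖≡𝟎⇒≡)
        w       = proj₁ w,⟨v,w⟩≢0
        ⟨v,w⟩≢0 = proj₂ w,⟨v,w⟩≢0

      common≤q^[d-1] : 2 ℕ.≤ d → ∣ P ∩ S ∩ S′ ∣ ℕ.≤ q ℕ.^ (d ℕ.∸ 1)
      common≤q^[d-1] 2≤d = ℕ.*-cancelʳ-≤ _ _ q {{ℕ.>-nonZero 1≤q}} (ℕ.≤-trans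
        (hyperplane-bound ⟨v,w⟩≢0 common! ⟨v,common⟩)
        -- Rewriting q^d as q · q^(d-1) takes 1 ≤ d, since `∸` truncates.
        (ℕ.≤-reflexive (≡.trans (≡.cong (q ℕ.^_) (≡.sym (ℕ.m+[n∸m]≡n (ℕ.<⇒≤ 2≤d)))) (ℕ.*-comm q _))))

      common≤2q^[d-2] : 3 ℕ.≤ d → ∣ P ∩ S ∩ S′ ∣ ℕ.≤ 2 ℕ.* q ℕ.^ (d ℕ.∸ 2)
      common≤2q^[d-2] 3≤d = ℕ.*-cancelʳ-≤ _ _ (q ℕ.* q) {{ℕ.>-nonZero (ℕ.*-mono-≤ 1≤q 1≤q)}} (begin
        ∣ P ∩ S ∩ S′ ∣ ℕ.* (q ℕ.* q)
          ≤⟨ (let u , ⟨v,u⟩≡0 , Qu≢0 = anisotropic-in-hyperplane nondegenerate 3≤d {v} {w} ⟨v,w⟩≢0 in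
              hyperplane∩sphere-bound ⟨v,w⟩≢0 ⟨v,u⟩≡0 Qu≢0 common! ⟨v,common⟩ (λ x∈ → proj₁ (∈common⁻ x∈))) ⟩
        2 ℕ.* q ℕ.^ d                               ≡⟨ ≡.cong (λ k → 2 ℕ.* q ℕ.^ k) (ℕ.m+[n∸m]≡n (ℕ.<⇒≤ 3≤d)) ⟨
        2 ℕ.* (q ℕ.* (q ℕ.* q ℕ.^ (d ℕ.∸ 2)))       ≡⟨ ≡.cong (2 ℕ.*_) (≡.trans (≡.sym (ℕ.*-assoc q q _)) (ℕ.*-comm (q ℕ.* q) _)) ⟩
        2 ℕ.* (q ℕ.^ (d ℕ.∸ 2) ℕ.* (q ℕ.* q))       ≡⟨ ℕ.*-assoc 2 (q ℕ.^ (d ℕ.∸ 2)) (q ℕ.* q) ⟨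
        2 ℕ.* q ℕ.^ (d ℕ.∸ 2) ℕ.* (q ℕ.* q)         ∎)
        where open ℕ.≤-Reasoning

-- From many incidences to many rich pairs and many spheres with partners.

module RichPairs {r ℓ₁ ℓ₂ c} (ℝ : EuclideanField r ℓ₁ ℓ₂) {q : ℕ} (𝔽 : FiniteField c q) {d : ℕ}
  (Q : Vec (FiniteField.Carrier 𝔽) d → FiniteField.Carrier 𝔽) where

  open EuclideanField ℝ
  open OrderedField ℝ
  open SemiringSolver commutativeSemiring
  open Geometry 𝔽 Q
  open Over ℝ
  open ≤-Reasoning

  private
    1≤q : 1 ℕ.≤ q
    1≤q = ℕ.<⇒≤ (FiniteFieldProperties.2≤q 𝔽)

  1≤q^ : ∀ k → 1 ℕ.≤ q ℕ.^ k
  1≤q^ k = ℕ.m^n>0 q {{ℕ.>-nonZero 1≤q}} k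

  σ≤#incidences : ∀ P 𝒮 → σ P 𝒮 ≤ ι (#incidences P 𝒮)
  σ≤#incidences P 𝒮 = 0≤y⇒x-y≤x (/-nonNeg (*-nonNeg (ι-nonNeg (length P)) (ι-nonNeg (length 𝒮))) (ι-pos 1≤q))

  module _ (P : List Point) (𝒮 : List Sphere) (𝒮! : Unique 𝒮) (K : Carrier) where

    open Witnessing P 𝒮 K

    private
      K² = K * K
      e  = ι (q ℕ.^ (d ℕ.∸ 1))
      m  = ι (length P)
      n  = ι (length 𝒮)
      I  = #incidences P 𝒮

      off : Sphere × Sphere → ℕ
      off = offDiagonal _∈ₛ?_ _≟ₛ_ P 𝒮!

      D : ℕ
      D = ∑ (cartesianProduct 𝒮 𝒮) off

    #pairs≡∑#partners : #pairs ≡ ∑ 𝒮 #partners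
    #pairs≡∑#partners = ≡.trans (count≡∑ _ (cartesianProduct 𝒮 𝒮)) (≡.trans (∑-cartesianProduct 𝒮 𝒮 _)
      (∑-cong 𝒮 λ S → ≡.sym (count≡∑ (witness? S) 𝒮)))

    module _ (P≢[] : P ≢ []) (𝒮≢[] : 𝒮 ≢ []) (0<K : 0# < K)
             (σ-large : (K * √ e) * √ (m * n) ≤ σ P 𝒮) (4m≤K²en : ι 4 * m ≤ (K² * e) * n) where

      private
        0<m : 0# < m
        0<m = ι-pos (nonempty⇒1≤length P≢[])

        0<n : 0# < n
        0<n = ι-pos (nonempty⇒1≤length 𝒮≢[])

        0≤mn : 0# ≤ m * n
        0≤mn = *-nonNeg (proj₁ 0<m) (proj₁ 0<n)

        0<e : 0# < e
        0<e = ι-pos (1≤q^ (d ℕ.∸ 1))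

        0<4n : 0# < ι 4 * n
        0<4n = *-pos (ι-suc-pos 3) 0<n

      -- Strictness matters: a pair with empty intersection can then never be rich, which rules out
      -- concentric spheres.
      0<threshold : 0# < threshold
      0<threshold = /-pos (*-pos (*-pos 0<K 0<K) 0<e) 0<4n

      private
        -- Squaring the lower bound for I removes both square roots; the left side may be squared
        -- because K > 0 makes it nonnegative.
        K²emn≤I² : (K² * e) * (m * n) ≤ ι I * ι I
        K²emn≤I² = begin
          (K² * e) * (m * n)
            ≈⟨ *-cong (*-congˡ (√-square (proj₁ 0<e))) (√-square 0≤mn) ⟨
          (K² * (√ e * √ e)) * (√ (m * n) * √ (m * n))
            ≈⟨ solve 3 (λ k a b → (k :* k :* (a :* a)) :* (b :* b) := ((k :* a) :* b) :* ((k :* a) :* b)) refl K (√ e) (√ (m * n)) ⟩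
          A * A       ≤⟨ *-mono-≤ (ι-nonNeg I) 0≤A A≤I A≤I ⟩
          ι I * ι I   ∎
          where
          A = (K * √ e) * √ (m * n)
          A≤I : A ≤ ι I
          A≤I = ≤-trans σ-large (σ≤#incidences P 𝒮)
          0≤A : 0# ≤ A
          0≤A = *-nonNeg (*-nonNeg (proj₁ 0<K) (√-nonNeg (proj₁ 0<e))) (√-nonNeg 0≤mn)

        -- Compared through squares: (2m)² ≤ K² e m n ≤ I². The 4 in the second hypothesis is the
        -- square of this 2.
        2m≤I : 2 ℕ.* length P ℕ.≤ I
        2m≤I = square≤square⇒≤ (ι-cancel-≤ (begin
          ι (2 ℕ.* length P ℕ.* (2 ℕ.* length P))     ≈⟨ trans (ι-* (2 ℕ.* length P) _) (*-cong (ι-* 2 (length P)) (ι-* 2 (length P))) ⟩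
          (ι 2 * m) * (ι 2 * m)                       ≈⟨ solve 2 (λ t m → (t :* m) :* (t :* m) := m :* (t :* t :* m)) refl (ι 2) m ⟩
          m * (ι 2 * ι 2 * m)                         ≈⟨ *-congˡ (*-congʳ (ι-* 2 2)) ⟨
          m * (ι 4 * m)                               ≤⟨ *-monoˡ-≤ (proj₁ 0<m) 4m≤K²en ⟩
          m * ((K² * e) * n)                          ≈⟨ solve 3 (λ m k n → m :* (k :* n) := k :* (m :* n)) refl m (K² * e) n ⟩
          (K² * e) * (m * n)                          ≤⟨ K²emn≤I² ⟩
          ι I * ι I                                   ≈⟨ ι-* I I ⟨
          ι (I ℕ.* I)                                 ∎))

        K²en≤2D : (K² * e) * n ≤ ι 2 * ι D
        K²en≤2D = *-cancelˡ-≤ 0<m (begin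
          m * ((K² * e) * n)                          ≈⟨ solve 3 (λ m k n → m :* (k :* n) := k :* (m :* n)) refl m (K² * e) n ⟩
          (K² * e) * (m * n)                          ≤⟨ K²emn≤I² ⟩
          ι I * ι I                                   ≈⟨ ι-* I I ⟨
          ι (I ℕ.* I)                                 ≤⟨ ι-mono-≤ (incidences²≤2*offDiagonal _∈ₛ?_ _≟ₛ_ P 𝒮! 2m≤I) ⟩
          ι (2 ℕ.* (length P ℕ.* D))                  ≈⟨ trans (ι-* 2 (length P ℕ.* D)) (*-congˡ (ι-* (length P) D)) ⟩
          ι 2 * (m * ι D)                             ≈⟨ solve 3 (λ t m d → t :* (m :* d) := m :* (t :* d)) refl (ι 2) m (ι D) ⟩
          m * (ι 2 * ι D)                             ∎)

      module _ {M : ℕ} (common≤M : ∀ S S′ → Witness S S′ → ∣ P ∩ S ∩ S′ ∣ ℕ.≤ M) where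

        private
          off≤M : ∀ p → Witness (proj₁ p) (proj₂ p) → off p ℕ.≤ M
          off≤M (S , S′) wit = ℕ.≤-trans (ℕ.*-monoˡ-≤ ∣ P ∩ S ∩ S′ ∣ (𝟙≤1 (¬? (S ≟ₛ S′))))
            (ℕ.≤-trans (ℕ.≤-reflexive (ℕ.*-identityˡ _)) (common≤M S S′ wit))

          off≤threshold : ∀ p → ¬ Witness (proj₁ p) (proj₂ p) → ι (off p) ≤ threshold
          off≤threshold (S , S′) ¬wit with S ≟ₛ S′
          -- For equal spheres the indicator makes `off` zero, whatever the size of the sphere.
          ... | yes S≡S′ = proj₁ 0<threshold
          ... | no  S≢S′ with total threshold (ι ∣ P ∩ S ∩ S′ ∣)
          ...   | inj₁ rich = contradiction (S≢S′ , rich) ¬wit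
          ...   | inj₂ poor = ≤-trans (≤-reflexive (trans (ι-* 1 ∣ P ∩ S ∩ S′ ∣) (trans (*-congʳ (+-identityʳ 1#)) (*-identityˡ _)))) poor

          R = ι #pairs

          D≤ : ι D ≤ threshold * (n * n) + ι M * R
          D≤ = begin
            ι D                                                       ≤⟨ ∑≤t*length+M*count (λ (S , S′) → witness? S S′) off M (proj₁ 0<threshold) off≤M off≤threshold (cartesianProduct 𝒮 𝒮) ⟩
            threshold * ι (length (cartesianProduct 𝒮 𝒮)) + ι M * R   ≡⟨ ≡.cong (λ k → threshold * ι k + ι M * R) (length-cartesianProductWith _,_ 𝒮 𝒮) ⟩
            threshold * ι (length 𝒮 ℕ.* length 𝒮) + ι M * R           ≈⟨ +-congʳ (*-congˡ (ι-* (length 𝒮) (length 𝒮))) ⟩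
            threshold * (n * n) + ι M * R                             ∎

        -- With X = K² e n, twice the bound X ≤ 2D gives 2X ≤ 4D, while the threshold share of 4D is
        -- exactly 4 n² T = X. One X cancels and the other bounds the rich pairs. `M` stays open so
        -- that both intersection bounds can be inserted.
        manyPairs : (K² * e) * n ≤ ι 4 * (ι M * R)
        manyPairs = +-cancelˡ-≤ X (begin
          X + X                                       ≤⟨ +-mono-≤ K²en≤2D K²en≤2D ⟩
          ι 2 * ι D + ι 2 * ι D                       ≈⟨ trans (sym (distribʳ (ι D) (ι 2) (ι 2))) (*-congʳ (sym (ι-+ 2 2))) ⟩
          ι 4 * ι D                                   ≤⟨ *-monoˡ-≤ (ι-nonNeg 4) D≤ ⟩
          ι 4 * (threshold * (n * n) + ι M * R)
            ≈⟨ solve 4 (λ f t n r → f :* (t :* (n :* n) :+ r) := (f :* n :* t) :* n :+ f :* r) refl (ι 4) threshold n (ι M * R) ⟩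
          (ι 4 * n * threshold) * n + ι 4 * (ι M * R) ≈⟨ +-congʳ (*-congʳ (*-/-cancel (K² * e) 0<4n)) ⟩
          X + ι 4 * (ι M * R)                         ∎)
          where X = (K² * e) * n

    manySpheres : 𝒮 ≢ [] → ∀ k {y} → 1 ℕ.≤ k → 0# ≤ y → y * n ≤ ι k * ι #pairs →
                  y / ι (2 ℕ.* k) ≤ ι (#spheresWithPartners≥ (y / ι (2 ℕ.* k)))
    manySpheres 𝒮≢[] k {y} 1≤k 0≤y yn≤kR = manyHeavy #partners 𝒮 (nonempty⇒1≤length 𝒮≢[]) (λ S → length-filter (witness? S) 𝒮)
      k 1≤k 0≤y (≡.subst (λ p → y * n ≤ ι k * ι p) #pairs≡∑#partners yn≤kR)

corollary3p2 : ∀ {r ℓ₁ ℓ₂ c} (ℝ : EuclideanField r ℓ₁ ℓ₂)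
    (q : ℕ) → OddPrimePower q →
    (𝔽 : FiniteField c q) →
    (d : ℕ) → 2 ℕ.≤ d →
    (Q : Vec (FiniteField.Carrier 𝔽) d → FiniteField.Carrier 𝔽) →
    let open EuclideanField ℝ
        open Geometry 𝔽 Q
        open Over ℝ
    in
    IsQuadraticForm → Nondegenerate →
    (P : List Point) → Unique P → P ≢ [] →
    (𝒮 : List Sphere) → Unique 𝒮 → 𝒮 ≢ [] →
    (K : Carrier) → 0# < K →
    let open Witnessing P 𝒮 K
        K² = K * K
    in
    (K * √ (ι (q ℕ.^ (d ℕ.∸ 1)))) * √ (ι (length P) * ι (length 𝒮)) ≤ σ P 𝒮 →
    ι 4 * ι (length P) ≤ (K² * ι (q ℕ.^ (d ℕ.∸ 1))) * ι (length 𝒮) →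
    ((K² * ι (length 𝒮)) / ι 4 ≤ ι #pairs)
    × (∀ S S′ → S ∈ 𝒮 → S′ ∈ 𝒮 → Witness S S′ →
         (center S ≢ center S′) × (threshold ≤ ι ∣ P ∩H⟨ S , S′ ⟩∣))
    × (K² / ι 8 ≤ ι (#spheresWithPartners≥ (K² / ι 8)))
    × (3 ℕ.≤ d →
         (((K² * ι q) * ι (length 𝒮)) / ι 8 ≤ ι #pairs)
         × ((K² * ι q) / ι 16 ≤ ι (#spheresWithPartners≥ ((K² * ι q) / ι 16))))
corollary3p2 ℝ q (_ , 2∤q) 𝔽 d 2≤d Q isQF nondeg P P! P≢[] 𝒮 𝒮! 𝒮≢[] K 0<K σ-large 4m≤K²en =
    y≤x*z⇒y/x≤z (ι-suc-pos 3) K²n≤4R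
  , (λ S S′ _ _ wit → witness⇒centers≢ S S′ wit , ≤-trans (proj₂ wit) (ι-mono-≤ (common≤hyperplane P! S S′)))
  , manySpheres P 𝒮 𝒮! K 𝒮≢[] 4 (s≤s z≤n) 0≤K² K²n≤4R
  , λ 3≤d → y≤x*z⇒y/x≤z (ι-suc-pos 7) (K²qn≤8R 3≤d)
          , manySpheres P 𝒮 𝒮! K 𝒮≢[] 8 (s≤s z≤n) (*-nonNeg 0≤K² (ι-nonNeg q)) (K²qn≤8R 3≤d)
  where
  open EuclideanField ℝ
  open OrderedField ℝ
  open SemiringSolver commutativeSemiring
  open Geometry 𝔽 Q
  open Over ℝ
  open Witnessing P 𝒮 K
  open IntersectionBounds 𝔽 2∤q Q isQF nondeg
  open RichPairs ℝ 𝔽 Q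
  open ≤-Reasoning

  n = ι (length 𝒮)
  R = ι #pairs

  0≤K² : 0# ≤ K * K
  0≤K² = *-nonNeg (proj₁ 0<K) (proj₁ 0<K)

  -- Concentric distinct spheres share no point, so richness would force the threshold below zero or
  -- equal to it.
  witness⇒centers≢ : ∀ S S′ → Witness S S′ → center S ≢ center S′
  witness⇒centers≢ S S′ (S≢S′ , rich) c≡c′ = proj₂ 0<T (≤-antisym (proj₁ 0<T)
    (≡.subst (λ k → threshold ≤ ι k) (concentric-disjoint P! S S′ S≢S′ c≡c′) rich))
    where
    0<T = 0<threshold P 𝒮 𝒮! K P≢[] 𝒮≢[] 0<K σ-large 4m≤K²en

  pairs-bound : ∀ {M} → (∀ S S′ → center S ≢ center S′ → ∣ P ∩ S ∩ S′ ∣ ℕ.≤ M) →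
                (K * K * ι (q ℕ.^ (d ℕ.∸ 1))) * n ≤ ι 4 * (ι M * R)
  pairs-bound common≤M = manyPairs P 𝒮 𝒮! K P≢[] 𝒮≢[] 0<K σ-large 4m≤K²en
    (λ S S′ wit → common≤M S S′ (witness⇒centers≢ S S′ wit))

  K²n≤4R : (K * K) * n ≤ ι 4 * R
  K²n≤4R = *-cancelˡ-≤ (ι-pos (1≤q^ (d ℕ.∸ 1))) (begin
    e * ((K * K) * n)     ≈⟨ solve 3 (λ e k n → e :* (k :* n) := (k :* e) :* n) refl e (K * K) n ⟩
    (K * K * e) * n       ≤⟨ pairs-bound (λ S S′ c≢c′ → common≤q^[d-1] P! S S′ c≢c′ 2≤d) ⟩
    ι 4 * (e * R)         ≈⟨ solve 3 (λ f e r → f :* (e :* r) := e :* (f :* r)) refl (ι 4) e R ⟩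
    e * (ι 4 * R)         ∎)
    where e = ι (q ℕ.^ (d ℕ.∸ 1))

  -- Here M = 2 q^(d-2) while e = q · q^(d-2): cancelling q^(d-2) leaves a gained factor q, and the
  -- 2 from the quadric turns 4 into 8.
  K²qn≤8R : 3 ℕ.≤ d → (K * K * ι q) * n ≤ ι 8 * R
  K²qn≤8R 3≤d = *-cancelˡ-≤ (ι-pos (1≤q^ (d ℕ.∸ 2))) (begin
    f * ((K * K * ι q) * n)                     ≈⟨ solve 4 (λ f k q n → f :* ((k :* q) :* n) := (k :* (q :* f)) :* n) refl f (K * K) (ι q) n ⟩
    (K * K * (ι q * f)) * n                     ≈⟨ *-congʳ (*-congˡ (ι-* q (q ℕ.^ (d ℕ.∸ 2)))) ⟨
    (K * K * ι (q ℕ.^ suc (d ℕ.∸ 2))) * n       ≡⟨ ≡.cong (λ k → (K * K * ι (q ℕ.^ k)) * n) (≡.sym (ℕ.+-∸-assoc 1 (ℕ.<⇒≤ 3≤d))) ⟩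
    (K * K * ι (q ℕ.^ (d ℕ.∸ 1))) * n           ≤⟨ pairs-bound (λ S S′ c≢c′ → common≤2q^[d-2] P! S S′ c≢c′ 3≤d) ⟩
    ι 4 * (ι (2 ℕ.* q ℕ.^ (d ℕ.∸ 2)) * R)       ≈⟨ *-congˡ (*-congʳ (ι-* 2 (q ℕ.^ (d ℕ.∸ 2)))) ⟩
    ι 4 * (ι 2 * f * R)                         ≈⟨ solve 4 (λ a b f r → a :* (b :* f :* r) := f :* (a :* b :* r)) refl (ι 4) (ι 2) f R ⟩
    f * (ι 4 * ι 2 * R)                         ≈⟨ *-congˡ (*-congʳ (ι-* 4 2)) ⟨
    f * (ι 8 * R)                               ∎)
    where f = ι (q ℕ.^ (d ℕ.∸ 2))
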